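{- Let $k \geq 2$ and let $H=(V,E)$ be a finite $k$-uniform hypergraph (without multiple edges) with $\Delta(H) \leq \Delta$ and $I(H)=I$, whose every vertex $v$ is equipped with a list $L_v$ of at least $R$ colors. Define $q_1:=1$ and $q_i:= \frac{i}{i-1}\sqrt[i]{i-1}$ for every $i > 1$. Then: (a) if $R \geq \left\lceil 2 + \sum_{i \in I} q_i \sqrt[i]{\frac{\Delta(\Delta-1)(k-1)}{k-i} 2^{k-i+1} f_i}\right\rceil$, there exists a list ieds-coloring of $H$; (b) if $R \geq \left\lceil 2 + \sum_{i \in I} q_i \sqrt[i]{\frac{\Delta(\Delta-1)(k-1)}{k-i}\, i!}\right\rceil$, there exists a list iedm-coloring of $H$.
   Context: For a hypergraph $H=(V,E)$ and $v\in V$, $E(v)$ is the set of edges containing $v$, $\deg v=|E(v)|$, and $\Delta(H)=\max_v \deg v$. $H$ is $k$-uniform if every edge has exactly $k$ vertices. For a $k$-uniform $H$, $I(H):=\{|P\setminus Q| : P,Q\in E\}\cap\{1,\dots,k-1\}$. $f_n$ denotes the number of total preorders of $\{1,\dots,n\}$ (orderings with possible ties; the ordered Bell / Fubini number), $f_n=\sum_{i=0}^n i!\,S(n,i)$ with $S(n,i)$ Stirling numbers of the second kind. For a coloring $\varphi: V\to\mathbb{N}$ and $X\subseteq V$, $\varphi(X)$ is the set and $\varphi\langle X\rangle$ the multiset of colors on $X$. A coloring $\varphi$ is an ieds-coloring if $\varphi(P)\neq\varphi(Q)$ for every pair of distinct intersecting edges $P,Q$; it is an iedm-coloring if $\varphi\langle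 P\rangle\neq\varphi\langle Q\rangle$ for every such pair. A list coloring is one where $\varphi(v)\in L_v$ for every vertex $v$. -}

module Defs where

open import Data.Nat as ℕ using (ℕ; zero; suc; _∸_; _≟_)
open import Data.Nat using (_!)
open import Data.Integer using (+_)
open import Data.Rational as ℚ using (ℚ; 0ℚ; 1ℚ)
open import Data.Fin using (Fin)
open import Data.Fin.Subset using (Subset; _∈_; _─_; ∣_∣; _∩_)
open import Data.Fin.Subset.Properties using (_∈?_)
open import Data.Vec using (tabulate)
open import Data.List using (List; length; filter)
import Data.List.Membership.Propositional as LM
open import Data.List.Relation.Unary.Unique.Propositional using (Unique)
open import Data.Product using (Σ; ∃; _×_)
open import Data.Sum using (_⊎_)
open import Relation.Nullary using (¬_; does)
open import Relation.Binary.PropositionalEquality using (_≡_; _≢_)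
open import Function.Bundles using (_⇔_)

stirling₂ : ℕ → ℕ → ℕ
stirling₂ zero    zero    = 1
stirling₂ zero    (suc i) = 0
stirling₂ (suc n) zero    = 0
stirling₂ (suc n) (suc i) = suc i ℕ.* stirling₂ n (suc i) ℕ.+ stirling₂ n i

sumℕ≤ : ℕ → (ℕ → ℕ) → ℕ
sumℕ≤ zero    g = g 0
sumℕ≤ (suc m) g = sumℕ≤ m g ℕ.+ g (suc m)

fubini : ℕ → ℕ
fubini n = sumℕ≤ n (λ i → (i !) ℕ.* stirling₂ n i)

⟦_⟧ : ℕ → ℚ
⟦ n ⟧ = + n ℚ./ 1

_^ℚ_ : ℚ → ℕ → ℚ
r ^ℚ zero  = 1ℚ
r ^ℚ suc i = r ℚ.* (r ^ℚ i)

sumℚ1 : ℕ → (ℕ → ℚ) → ℚ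
sumℚ1 zero    r = 0ℚ
sumℚ1 (suc m) r = sumℚ1 m r ℚ.+ r (suc m)

record Hypergraph (n : ℕ) : Set where
  field
    edges  : List (Subset n)
    simple : Unique edges

open Hypergraph public

edgesAt : ∀ {n} → Hypergraph n → Fin n → List (Subset n)
edgesAt H v = filter (v ∈?_) (edges H)

deg : ∀ {n} → Hypergraph n → Fin n → ℕ
deg H v = length (edgesAt H v)

MaxDegree≤ : ∀ {n} → Hypergraph n → ℕ → Set
MaxDegree≤ H Δ = ∀ v → deg H v ℕ.≤ Δ

Uniform : ∀ {n} → ℕ → Hypergraph n → Set
Uniform k H = ∀ P → P LM.∈ edges H → ∣ P ∣ ≡ k

InI : ∀ {n} → ℕ → Hypergraph n → ℕ → Set
InI k H i = (1 ℕ.≤ i) × (i ℕ.≤ k ∸ 1) ×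
  Σ (Subset _) λ P → Σ (Subset _) λ Q →
    P LM.∈ edges H × Q LM.∈ edges H × ∣ P ─ Q ∣ ≡ i

Intersect : ∀ {n} → Subset n → Subset n → Set
Intersect P Q = ∃ λ v → v ∈ P × v ∈ Q

SameColorSet : ∀ {n} → (Fin n → ℕ) → Subset n → Subset n → Set
SameColorSet φ P Q = ∀ c → (∃ λ v → v ∈ P × φ v ≡ c) ⇔ (∃ λ v → v ∈ Q × φ v ≡ c)

colorCount : ∀ {n} → (Fin n → ℕ) → Subset n → ℕ → ℕ
colorCount φ X c = ∣ X ∩ tabulate (λ v → does (φ v ≟ c)) ∣

SameColorMultiset : ∀ {n} → (Fin n → ℕ) → Subset n → Subset n → Set
SameColorMultiset φ P Q = ∀ c → colorCount φ P c ≡ colorCount φ Q c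

IEDS : ∀ {n} → Hypergraph n → (Fin n → ℕ) → Set
IEDS H φ = ∀ P Q → P LM.∈ edges H → Q LM.∈ edges H → P ≢ Q →
  Intersect P Q → ¬ SameColorSet φ P Q

IEDM : ∀ {n} → Hypergraph n → (Fin n → ℕ) → Set
IEDM H φ = ∀ P Q → P LM.∈ edges H → Q LM.∈ edges H → P ≢ Q →
  Intersect P Q → ¬ SameColorMultiset φ P Q

ListColoring : ∀ {n} → (Fin n → List ℕ) → (Fin n → ℕ) → Set
ListColoring L φ = ∀ v → φ v LM.∈ L v

-- The real-valued bound, encoded exactly in ℚ.
--
-- q_i = i/(i-1) · (i-1)^{1/i}, so q_i^i = i^i / (i-1)^{i-1} (also for i = 1,
-- with 0^0 = 1).  For a radicand x_i = num_i / (k - i) (with k - i ≥ 1 for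
-- i ∈ I), the summand a_i = q_i · x_i^{1/i} ≥ 0 satisfies, for r ∈ ℚ,
--   r < a_i  ⇔  r < 0  ∨  (0 ≤ r ∧ r^i < q_i^i · x_i)
--            ⇔  r < 0  ∨  (0 ≤ r ∧ r^i · (i-1)^{i-1} · (k-i) < i^i · num_i).
-- `num` is the numerator of the radicand, i.e.
--   (a): Δ(Δ-1)(k-1) · 2^{k-i+1} · f_i        (b): Δ(Δ-1)(k-1) · i!

numA : ℕ → ℕ → ℕ → ℕ
numA k Δ i = Δ ℕ.* (Δ ∸ 1) ℕ.* (k ∸ 1) ℕ.* (2 ℕ.^ (k ∸ i ℕ.+ 1)) ℕ.* fubini i

numB : ℕ → ℕ → ℕ → ℕ
numB k Δ i = Δ ℕ.* (Δ ∸ 1) ℕ.* (k ∸ 1) ℕ.* (i !)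

-- r < q_i · (num / (k-i))^{1/i}
BelowTerm : (k i num : ℕ) → ℚ → Set
BelowTerm k i num r =
  (r ℚ.< 0ℚ) ⊎
  ((0ℚ ℚ.≤ r) × ((r ^ℚ i) ℚ.* ⟦ ((i ∸ 1) ℕ.^ (i ∸ 1)) ℕ.* (k ∸ i) ⟧ ℚ.< ⟦ (i ℕ.^ i) ℕ.* num ⟧))

-- ⌈ 2 + Σ_{i ∈ I(H)} q_i (num_i/(k-i))^{1/i} ⌉ ≤ R.
-- Since R is an integer this is  Σ_{i∈I} a_i ≤ R - 2, and a finite sum of
-- reals is ≤ c iff every choice of rationals r_i < a_i has Σ r_i ≤ c.
-- Indices i ∉ I (in 1..k-1) contribute r_i = 0.
BoundHolds : ∀ {n} → (k : ℕ) → Hypergraph n → (num : ℕ → ℕ) → (R : ℕ) → Set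
BoundHolds k H num R =
  (r : ℕ → ℚ) →
  (∀ i → 1 ℕ.≤ i → i ℕ.≤ k ∸ 1 → InI k H i → BelowTerm k i (num i) (r i)) →
  (∀ i → 1 ℕ.≤ i → i ℕ.≤ k ∸ 1 → ¬ InI k H i → r i ≡ 0ℚ) →
  sumℚ1 (k ∸ 1) r ℚ.≤ ⟦ R ⟧ ℚ.- ⟦ 2 ⟧

{-# OPTIONS --safe #-}

-- Rosenfeld's counting method.  Call a colouring good on a set S of vertices if no
-- two distinct intersecting edges P, Q whose symmetric difference lies in S have
-- the same colours on S; this is inherited by subsets of S.  One shows by
-- induction on S that every further vertex v multiplies the number of good partial
-- colourings by at least β = 1 + Σ (i-1)/i · a_i, where a_i is the i-th summand
-- of the bound on R.
--
-- A good colouring of S extended to v is bad only because of some pair of edges.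
-- If v ∈ P \ Q, uncolour the i vertices of P \ Q: at most 2^(k-i) f_i
-- (respectively i!) ways of recolouring them restore the conflict.  If v ∈ P ∩ Q,
-- which matters for sets only, some u ∈ P \ Q has the colour of v; uncolour v and
-- P \ Q except u.  By induction uncolouring costs a factor β^(i-1), and there are
-- at most Δ(Δ-1)(k-1)/(k-i) pairs (P, Q) of either kind.  With x_i the radicand
-- in a_i, every good colouring of S therefore has on average at most
-- Σ x_i β^(1-i) ≤ Σ a_i / i bad extensions, and R ≥ β + Σ a_i / i.
--
-- The real number β is replaced by B / M with natural numbers B and M, and the
-- number of good partial colourings of S by the number of colourings of all
-- vertices that are good on S.

module Submission where

open import Defs
open import Data.Nat as ℕ using (ℕ; zero; suc; _+_; _*_; _∸_; _^_; _!; _≤_; _<_; z≤n; s≤s; _≟_; _≤?_; NonZero; >-nonZero)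
open import Data.Nat.Properties
open import Data.Nat.Tactic.RingSolver using (solve-∀)
open import Algebra.Properties.CommutativeSemigroup +-commutativeSemigroup using () renaming (interchange to +-interchange)
open import Algebra.Properties.CommutativeSemigroup *-commutativeSemigroup using () renaming (x∙yz≈y∙xz to *-leftComm; interchange to *-interchange)
open import Data.Fin as Fin using (Fin)
import Data.Fin.Properties as Finₚ
open import Data.Fin.Subset using (Subset; inside; outside; ∣_∣; _∩_; _─_; _∈_; _∉_)
open import Data.Fin.Subset.Properties using (_∈?_; x∈p∩q⁺; x∈p∩q⁻; p─q⊆p; x∈p∧x∉q⇒x∈p─q; p∩q≢∅⇒∣p─q∣<∣p∣; ∩-comm)
open import Data.List using (List; []; _∷_; _++_; map; filter; length; allFin; concatMap; deduplicate; lookup)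
open import Data.List.Properties using (length-map; length-++; length-tabulate; filter-notAll; filter-++; filter-all; filter-accept; filter-reject; filter-none; map-∘; map-cong-local)
open import Data.List.Membership.Propositional renaming (_∈_ to _∈ₗ_; _∉_ to _∉ₗ_) using (find; lose)
open import Data.List.Membership.Propositional.Properties
open import Data.List.Relation.Unary.Any as Any using (Any; here; there)
open import Data.List.Relation.Unary.All as All using (All; []; _∷_)
open import Data.List.Relation.Unary.AllPairs using ([]; _∷_)
open import Data.List.Relation.Unary.Unique.Propositional using (Unique)
import Data.List.Relation.Unary.Unique.Propositional.Properties as Uniqueₚ
open import Data.List.Relation.Unary.Unique.DecPropositional.Properties _≟_ using (deduplicate-!)
open import Data.List.Relation.Binary.Subset.Propositional using (_⊆_)
open import Data.Vec as Vec using (Vec; []; _∷_; _[_]≔_; here; there)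
import Data.Vec.Properties as Vecₚ
import Data.Bool.Properties as Boolₚ
open import Data.Product using (Σ; ∃; _×_; _,_; proj₁; proj₂; swap)
open import Data.Sum using (_⊎_; inj₁; inj₂; [_,_]′)
open import Data.Empty using (⊥; ⊥-elim)
open import Function using (_∘_; id; Equivalence)
open import Relation.Nullary using (¬_; Dec; yes; no; does; ¬?; contradiction; _×-dec_; _→-dec_)
import Relation.Nullary.Decidable as Dec
open import Relation.Binary.PropositionalEquality hiding ([_])
import Data.List.Membership.DecPropositional _≟_ as ℕ∈
import Data.Integer as ℤ
import Data.Integer.Properties as ℤₚ
open import Data.Rational as ℚ using (ℚ; 0ℚ; 1ℚ)
import Data.Rational.Properties as ℚₚ
open import Data.Rational.Unnormalised as ℚᵘ using (ℚᵘ; mkℚᵘ; *≡*; *≤*; *<*)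
import Data.Rational.Unnormalised.Properties as ℚᵘₚ
open import Algebra.Bundles using (CommutativeMonoid)
import Algebra.Properties.CommutativeSemigroup (CommutativeMonoid.commutativeSemigroup ℚₚ.*-1-commutativeMonoid) as ℚ*
import Algebra.Properties.CommutativeSemigroup (CommutativeMonoid.commutativeSemigroup ℚₚ.+-0-commutativeMonoid) as ℚ+

-- Finite sums and indicators

-- The constants q_i come from an optimisation. Adding v to S requires R ≥ β + Σ x_i β^(1-i). For
-- x_i > 0, the number q_i x_i^(1/i) is the infimum of y + x_i y^(1-i) over y > 0: for i > 1 it is
-- attained at y = ((i-1) x_i)^(1/i) = (i-1)/i · a_i, where the second summand equals a_i / i; for i
-- = 1 it is x_1. As β is at least each of these y, every summand x_i β^(1-i) can be estimated with
-- its own optimal y, and the separate optima add up. For sets the obstacle is v ∈ P ∩ Q: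
-- recolouring P ─ Q alone does not touch v, so the factor R of the new vertex would be missing. The
-- vertex u with the colour of v repairs this. It keeps its colour and thereby dictates that of v,
-- so v takes its place among the i uncoloured vertices. The price is i choices of u, the gain is
-- f_(i-1) in place of f_i, and i f_(i-1) ≤ f_i settles the balance. Both kinds of pairs thus cost
-- 2^(k-i) f_i, which together give 2^(k-i+1) f_i.

private variable
  I I′ : Set

∑ : List I → (I → ℕ) → ℕ
∑ []       f = 0
∑ (x ∷ xs) f = f x + ∑ xs f

∑-mono : ∀ (xs : List I) {f g : I → ℕ} → (∀ x → x ∈ₗ xs → f x ≤ g x) → ∑ xs f ≤ ∑ xs g
∑-mono []       h = z≤n
∑-mono (x ∷ xs) h = +-mono-≤ (h x (here refl)) (∑-mono xs (λ y y∈ → h y (there y∈)))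

∑-cong : ∀ (xs : List I) {f g : I → ℕ} → (∀ x → f x ≡ g x) → ∑ xs f ≡ ∑ xs g
∑-cong []       h = refl
∑-cong (x ∷ xs) h = cong₂ _+_ (h x) (∑-cong xs h)

∑-+ : ∀ (xs : List I) (f g : I → ℕ) → ∑ xs (λ x → f x + g x) ≡ ∑ xs f + ∑ xs g
∑-+ []       f g = refl
∑-+ (x ∷ xs) f g = trans (cong (f x + g x +_) (∑-+ xs f g)) (+-interchange (f x) (g x) _ _)

∑-* : ∀ (xs : List I) (c : ℕ) (f : I → ℕ) → ∑ xs (λ x → c * f x) ≡ c * ∑ xs f
∑-* []       c f = sym (*-zeroʳ c)
∑-* (x ∷ xs) c f = trans (cong (c * f x +_) (∑-* xs c f)) (sym (*-distribˡ-+ c (f x) _))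

∑-const : ∀ (xs : List I) (c : ℕ) → ∑ xs (λ _ → c) ≡ length xs * c
∑-const []       c = refl
∑-const (x ∷ xs) c = cong (c +_) (∑-const xs c)

∑-swap : ∀ (xs : List I) (ys : List I′) (f : I → I′ → ℕ) →
  ∑ xs (λ x → ∑ ys (f x)) ≡ ∑ ys (λ y → ∑ xs (λ x → f x y))
∑-swap []       ys f = sym (trans (∑-const ys 0) (*-zeroʳ (length ys)))
∑-swap (x ∷ xs) ys f = trans (cong (∑ ys (f x) +_) (∑-swap xs ys f)) (sym (∑-+ ys (f x) _))

∑-++ : ∀ (xs ys : List I) (f : I → ℕ) → ∑ (xs ++ ys) f ≡ ∑ xs f + ∑ ys f
∑-++ []       ys f = refl
∑-++ (x ∷ xs) ys f = trans (cong (f x +_) (∑-++ xs ys f)) (sym (+-assoc (f x) _ _))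

∑-map : ∀ (g : I → I′) (xs : List I) (f : I′ → ℕ) → ∑ (map g xs) f ≡ ∑ xs (f ∘ g)
∑-map g []       f = refl
∑-map g (x ∷ xs) f = cong (f (g x) +_) (∑-map g xs f)

∑-concatMap : ∀ (g : I → List I′) (xs : List I) (f : I′ → ℕ) →
  ∑ (concatMap g xs) f ≡ ∑ xs (λ x → ∑ (g x) f)
∑-concatMap g []       f = refl
∑-concatMap g (x ∷ xs) f =
  trans (∑-++ (g x) (concatMap g xs) f) (cong (∑ (g x) f +_) (∑-concatMap g xs f))

∑-term : ∀ {xs : List I} (f : I → ℕ) {x} → x ∈ₗ xs → f x ≤ ∑ xs f
∑-term f (here refl) = m≤m+n _ _
∑-term f (there x∈)  = ≤-trans (∑-term f x∈) (m≤n+m _ _)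

∑-zero : ∀ (xs : List I) {f : I → ℕ} → (∀ x → x ∈ₗ xs → f x ≡ 0) → ∑ xs f ≡ 0
∑-zero []       h = refl
∑-zero (x ∷ xs) h = cong₂ _+_ (h x (here refl)) (∑-zero xs (λ y y∈ → h y (there y∈)))

ind : ∀ {P : Set} → Dec P → ℕ
ind (yes _) = 1
ind (no  _) = 0

ind-yes : ∀ {P : Set} (d : Dec P) → P → ind d ≡ 1
ind-yes (yes _) p = refl
ind-yes (no ¬p) p = ⊥-elim (¬p p)

ind-no : ∀ {P : Set} (d : Dec P) → ¬ P → ind d ≡ 0
ind-no (yes p) ¬p = ⊥-elim (¬p p)
ind-no (no  _) ¬p = refl

ind-mono : ∀ {P Q : Set} (d : Dec P) (e : Dec Q) → (P → Q) → ind d ≤ ind e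
ind-mono (yes p) e f = ≤-reflexive (sym (ind-yes e (f p)))
ind-mono (no _)  e f = z≤n

ind-≤ : ∀ {P : Set} (d : Dec P) {m : ℕ} → (P → 1 ≤ m) → ind d ≤ m
ind-≤ (yes p) f = f p
ind-≤ (no _)  f = z≤n

ind-⊎ : ∀ {P Q S : Set} (d : Dec P) (e : Dec Q) (s : Dec S) → (P → Q ⊎ S) → ind d ≤ ind e + ind s
ind-⊎ d e s f = ind-≤ d λ p → [ (λ q → ≤-trans (≤-reflexive (sym (ind-yes e q))) (m≤m+n _ _))
                              , (λ x → ≤-trans (≤-reflexive (sym (ind-yes s x))) (m≤n+m _ _)) ]′ (f p)

∑-ind>0 : ∀ {P : I → Set} (P? : ∀ x → Dec (P x)) (xs : List I) →
  0 < ∑ xs (λ x → ind (P? x)) → ∃ P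
∑-ind>0 P? (x ∷ xs) h with P? x
... | yes p = x , p
... | no _  = ∑-ind>0 P? xs h

∑-ind-unique : ∀ {P : I → Set} (P? : ∀ x → Dec (P x)) {xs : List I} → Unique xs →
  (∀ {x y} → P x → P y → x ≡ y) → ∑ xs (λ x → ind (P? x)) ≤ 1
∑-ind-unique P? []       h = z≤n
∑-ind-unique P? {x ∷ xs} (x∉ ∷ u) h with P? x
... | no _   = ∑-ind-unique P? u h
... | yes px = ≤-reflexive (cong suc (∑-zero xs λ y y∈ →
                 ind-no (P? y) λ py → All.lookup x∉ y∈ (h px py)))

length-filter-∑ : ∀ {P : I → Set} (P? : ∀ x → Dec (P x)) (xs : List I) →
  length (filter P? xs) ≡ ∑ xs (λ x → ind (P? x))
length-filter-∑ P? []       = refl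
length-filter-∑ P? (x ∷ xs) with P? x
... | yes _ = cong suc (length-filter-∑ P? xs)
... | no _  = length-filter-∑ P? xs

∑-filter-≤ : ∀ {P : I → Set} (P? : ∀ x → Dec (P x)) (xs : List I) {f g : I → ℕ} →
  (∀ x → P x → f x ≤ g x) → ∑ (filter P? xs) f ≤ ∑ xs g
∑-filter-≤ P? []       h = z≤n
∑-filter-≤ P? (x ∷ xs) h with P? x
... | yes p = +-mono-≤ (h x p) (∑-filter-≤ P? xs h)
... | no _  = ≤-trans (∑-filter-≤ P? xs h) (m≤n+m _ _)

-- Sums over colourings

module Coordinates {R : ℕ} where

  vectors : ∀ n → List (Vec (Fin R) n)
  vectors zero    = [] ∷ []
  vectors (suc n) = concatMap (λ c → map (c ∷_) (vectors n)) (allFin R)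

  total : ∀ {n} → (Vec (Fin R) n → ℕ) → ℕ
  total = ∑ (vectors _)

  total-suc : ∀ {n} (F : Vec (Fin R) (suc n) → ℕ) →
    total F ≡ ∑ (allFin R) (λ c → total (λ w → F (c ∷ w)))
  total-suc {n} F = trans (∑-concatMap _ (allFin R) F)
                          (∑-cong (allFin R) (λ c → ∑-map (c ∷_) (vectors n) F))

  vectors-nonempty : ∀ n → 1 ≤ R → 0 < length (vectors n)
  vectors-nonempty n R≥1 = ∈-length (go n)
    where
    c₀ : Fin R
    c₀ = Fin.fromℕ< R≥1
    go : ∀ n → Vec.replicate n c₀ ∈ₗ vectors n
    go zero    = here refl
    go (suc n) = ∈-concatMap⁺ (λ c → map (c ∷_) (vectors n)) (lose (∈-allFin c₀) (∈-map⁺ (c₀ ∷_) (go n)))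

  ∑ᶜ : ∀ {n} → Fin n → (Vec (Fin R) n → ℕ) → Vec (Fin R) n → ℕ
  ∑ᶜ v F φ = ∑ (allFin R) (λ c → F (φ [ v ]≔ c))

  ∑ᶜˢ : ∀ {n} → List (Fin n) → (Vec (Fin R) n → ℕ) → Vec (Fin R) n → ℕ
  ∑ᶜˢ []       F = F
  ∑ᶜˢ (u ∷ us) F = ∑ᶜ u (∑ᶜˢ us F)

  ∑-allFin-const : ∀ c → ∑ (allFin R) (λ _ → c) ≡ R * c
  ∑-allFin-const c = trans (∑-const (allFin R) c) (cong (_* c) (length-tabulate {n = R} id))

  -- A colouring arises as `φ [ v ]≔ c` from exactly `R` pairs: `c` is its colour at `v`, and the
  -- old colour of `φ` at `v` is arbitrary.
  total-∑ᶜ : ∀ {n} (v : Fin n) (F : Vec (Fin R) n → ℕ) → total (∑ᶜ v F) ≡ R * total F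
  total-∑ᶜ {suc n} Fin.zero F = begin
    total (∑ᶜ Fin.zero F)                                               ≡⟨ total-suc (∑ᶜ Fin.zero F) ⟩
    ∑ (allFin R) (λ _ → total λ w → ∑ (allFin R) (λ c → F (c ∷ w)))    ≡⟨ ∑-allFin-const _ ⟩
    R * total (λ w → ∑ (allFin R) (λ c → F (c ∷ w)))                    ≡⟨ cong (R *_) (∑-swap (vectors n) (allFin R) (λ w c → F (c ∷ w))) ⟩
    R * ∑ (allFin R) (λ c → total (λ w → F (c ∷ w)))                    ≡⟨ cong (R *_) (total-suc F) ⟨
    R * total F ∎ where open ≡-Reasoning
  total-∑ᶜ {suc n} (Fin.suc v) F = begin
    total (∑ᶜ (Fin.suc v) F)                                            ≡⟨ total-suc (∑ᶜ (Fin.suc v) F) ⟩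
    ∑ (allFin R) (λ c → total (∑ᶜ v (λ w → F (c ∷ w))))                 ≡⟨ ∑-cong (allFin R) (λ c → total-∑ᶜ v (λ w → F (c ∷ w))) ⟩
    ∑ (allFin R) (λ c → R * total (λ w → F (c ∷ w)))                    ≡⟨ ∑-* (allFin R) R _ ⟩
    R * ∑ (allFin R) (λ c → total (λ w → F (c ∷ w)))                    ≡⟨ cong (R *_) (total-suc F) ⟨
    R * total F ∎ where open ≡-Reasoning

  total-∑ᶜˢ : ∀ {n} (us : List (Fin n)) (F : Vec (Fin R) n → ℕ) →
    total (∑ᶜˢ us F) ≡ R ^ length us * total F
  total-∑ᶜˢ []       F = sym (+-identityʳ _)
  total-∑ᶜˢ (u ∷ us) F = begin
    total (∑ᶜ u (∑ᶜˢ us F))             ≡⟨ total-∑ᶜ u (∑ᶜˢ us F) ⟩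
    R * total (∑ᶜˢ us F)                ≡⟨ cong (R *_) (total-∑ᶜˢ us F) ⟩
    R * (R ^ length us * total F)       ≡⟨ *-assoc R _ _ ⟨
    R ^ suc (length us) * total F ∎ where open ≡-Reasoning

  AgreeOff : ∀ {n} → List (Fin n) → Vec (Fin R) n → Vec (Fin R) n → Set
  AgreeOff us φ ψ = ∀ x → x ∉ₗ us → Vec.lookup φ x ≡ Vec.lookup ψ x

  agreeOff-∷ : ∀ {n} {us : List (Fin n)} {φ ψ u c} → AgreeOff us (φ [ u ]≔ c) ψ → AgreeOff (u ∷ us) φ ψ
  agreeOff-∷ {φ = φ} {u = u} {c} h x x∉ =
    trans (sym (Vecₚ.lookup∘update′ (x∉ ∘ here) φ c)) (h x (x∉ ∘ there))

  ∑ᶜˢ-zero : ∀ {n} (us : List (Fin n)) {F : Vec (Fin R) n → ℕ} φ →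
    (∀ ψ → AgreeOff us φ ψ → F ψ ≡ 0) → ∑ᶜˢ us F φ ≡ 0
  ∑ᶜˢ-zero []       φ h = h φ (λ _ _ → refl)
  ∑ᶜˢ-zero (u ∷ us) φ h = ∑-zero (allFin R) λ c _ →
    ∑ᶜˢ-zero us (φ [ u ]≔ c) (λ ψ agr → h ψ (agreeOff-∷ {us = us} {φ} {ψ} agr))

  -- Double counting: summing over all recolourings of `us` counts each member of `E` exactly
  -- `R ^ length us` times. By locality only those `φ` in `G` contribute to this sum, each at most
  -- `m`.
  total-uncolour : ∀ {n} {E G : Vec (Fin R) n → Set} (E? : ∀ φ → Dec (E φ)) (G? : ∀ φ → Dec (G φ))
    (us : List (Fin n)) (m : ℕ) →
    (∀ φ ψ → AgreeOff us φ ψ → E ψ → G φ) →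
    (∀ φ → ∑ᶜˢ us (ind ∘ E?) φ ≤ m) →
    R ^ length us * total (ind ∘ E?) ≤ m * total (ind ∘ G?)
  total-uncolour {n} E? G? us m loc bound = begin
    R ^ length us * total (ind ∘ E?)       ≡⟨ total-∑ᶜˢ us (ind ∘ E?) ⟨
    total (∑ᶜˢ us (ind ∘ E?))              ≤⟨ ∑-mono (vectors n) (λ φ _ → pointwise φ) ⟩
    total (λ φ → m * ind (G? φ))           ≡⟨ ∑-* (vectors n) m (ind ∘ G?) ⟩
    m * total (ind ∘ G?) ∎
    where
    open ≤-Reasoning
    pointwise : ∀ φ → ∑ᶜˢ us (ind ∘ E?) φ ≤ m * ind (G? φ)
    pointwise φ with G? φ
    ... | yes _ = ≤-trans (bound φ) (≤-reflexive (sym (*-identityʳ m)))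
    ... | no ¬g = ≤-reflexive (trans (∑ᶜˢ-zero us φ (λ ψ agr → ind-no (E? ψ) (¬g ∘ loc φ ψ agr)))
                                     (sym (*-zeroʳ m)))

-- Surjections and Fubini numbers

-- The number of surjections from an n-set onto an i-set.
surj : ℕ → ℕ → ℕ
surj n i = i ! * stirling₂ n i

-- The new element has `suc i` possible images; the remaining elements map either onto everything or
-- onto the complement of that image.
surj-suc : ∀ n i → surj (suc n) (suc i) ≡ suc i * (surj n (suc i) + surj n i)
surj-suc n i = lemma (suc i) (i !) (stirling₂ n (suc i)) (stirling₂ n i)
  where
  lemma : ∀ a b c d → a * b * (a * c + d) ≡ a * (a * b * c + b * d)
  lemma = solve-∀

surj-zero : ∀ n i → n < i → surj n i ≡ 0
surj-zero zero    (suc i) _         = *-zeroʳ (suc i !)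
surj-zero (suc n) (suc i) (s≤s n<i) = begin
  surj (suc n) (suc i)                    ≡⟨ surj-suc n i ⟩
  suc i * (surj n (suc i) + surj n i)     ≡⟨ cong₂ (λ a b → suc i * (a + b)) (surj-zero n (suc i) (m≤n⇒m≤1+n n<i)) (surj-zero n i n<i) ⟩
  suc i * 0                               ≡⟨ *-zeroʳ (suc i) ⟩
  0 ∎ where open ≡-Reasoning

sumℕ≤-term : ∀ m g i → i ≤ m → g i ≤ sumℕ≤ m g
sumℕ≤-term zero    g .zero z≤n = ≤-refl
sumℕ≤-term (suc m) g i i≤ with m≤n⇒m<n∨m≡n i≤
... | inj₁ (s≤s i≤m) = ≤-trans (sumℕ≤-term m g i i≤m) (m≤m+n _ _)
... | inj₂ refl      = m≤n+m _ _

sumℕ≤-mono : ∀ m {g h} → (∀ i → g i ≤ h i) → sumℕ≤ m g ≤ sumℕ≤ m h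
sumℕ≤-mono zero    le = le 0
sumℕ≤-mono (suc m) le = +-mono-≤ (sumℕ≤-mono m le) (le (suc m))

sumℕ≤-cong : ∀ m {g h} → (∀ i → g i ≡ h i) → sumℕ≤ m g ≡ sumℕ≤ m h
sumℕ≤-cong zero    eq = eq 0
sumℕ≤-cong (suc m) eq = cong₂ _+_ (sumℕ≤-cong m eq) (eq (suc m))

sumℕ≤-+ : ∀ m g h → sumℕ≤ m (λ i → g i + h i) ≡ sumℕ≤ m g + sumℕ≤ m h
sumℕ≤-+ zero    g h = refl
sumℕ≤-+ (suc m) g h = trans (cong (_+ (g (suc m) + h (suc m))) (sumℕ≤-+ m g h)) (+-interchange (sumℕ≤ m g) _ _ _)

sumℕ≤-* : ∀ m c g → sumℕ≤ m (λ i → c * g i) ≡ c * sumℕ≤ m g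
sumℕ≤-* zero    c g = refl
sumℕ≤-* (suc m) c g = trans (cong (_+ c * g (suc m)) (sumℕ≤-* m c g)) (sym (*-distribˡ-+ c _ _))

sumℕ≤-shift : ∀ m g → sumℕ≤ (suc m) g ≡ g 0 + sumℕ≤ m (g ∘ suc)
sumℕ≤-shift zero    g = refl
sumℕ≤-shift (suc m) g = trans (cong (_+ g (suc (suc m))) (sumℕ≤-shift m g)) (+-assoc (g 0) _ _)

surj≤fubini : ∀ n i → surj n i ≤ fubini n
surj≤fubini n i with i ≤? n
... | yes i≤n = sumℕ≤-term n (surj n) i i≤n
... | no  i≰n = ≤-trans (≤-reflexive (surj-zero n i (≰⇒> i≰n))) z≤n

-- Divided by `fubini n`, this is the mean of `w` at the number of blocks of a random total
-- preorder.
moment : (ℕ → ℕ) → ℕ → ℕ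
moment w n = sumℕ≤ n (λ j → w j * surj n j)

-- Summation by parts moves the recurrence of `surj` onto the weight. Combinatorially, a new element
-- joins one of the j blocks or forms a block of its own in one of j + 1 gaps.
moment-suc : ∀ w n → moment w (suc n) ≡ moment (λ j → j * w j + suc j * w (suc j)) n
moment-suc w n = begin
  moment w (suc n)                                                  ≡⟨ sumℕ≤-shift n _ ⟩
  w 0 * 0 + sumℕ≤ n (λ j → w (suc j) * surj (suc n) (suc j))        ≡⟨ cong₂ _+_ (*-zeroʳ (w 0)) (sumℕ≤-cong n eq) ⟩
  sumℕ≤ n (λ j → h (suc j) + g j)                                   ≡⟨ sumℕ≤-+ n (h ∘ suc) g ⟩
  sumℕ≤ n (h ∘ suc) + sumℕ≤ n g                                     ≡⟨ cong (_+ sumℕ≤ n g) (sym (sumℕ≤-shift n h)) ⟩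
  sumℕ≤ (suc n) h + sumℕ≤ n g                                       ≡⟨ cong (_+ sumℕ≤ n g) drop-last ⟩
  sumℕ≤ n h + sumℕ≤ n g                                             ≡⟨ sumℕ≤-+ n h g ⟨
  sumℕ≤ n (λ j → h j + g j)                                         ≡⟨ sumℕ≤-cong n (λ j → sym (*-distribʳ-+ (surj n j) (j * w j) (suc j * w (suc j)))) ⟩
  moment (λ j → j * w j + suc j * w (suc j)) n ∎
  where
  open ≡-Reasoning
  h g : ℕ → ℕ
  h j = j * w j * surj n j
  g j = suc j * w (suc j) * surj n j
  lemma : ∀ a b c d → a * (b * (c + d)) ≡ b * a * c + b * a * d
  lemma = solve-∀
  eq : ∀ j → w (suc j) * surj (suc n) (suc j) ≡ h (suc j) + g j
  eq j = trans (cong (w (suc j) *_) (surj-suc n j)) (lemma (w (suc j)) (suc j) _ _)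
  drop-last : sumℕ≤ (suc n) h ≡ sumℕ≤ n h
  drop-last = trans (cong (sumℕ≤ n h +_) (trans (cong (suc n * w (suc n) *_) (surj-zero n (suc n) ≤-refl)) (*-zeroʳ (suc n * w (suc n)))))
                    (+-identityʳ _)

-- This is (2j - n)² ≥ 0 without subtraction; `d` is the distance of n and 2j.
4nj≤4j²+n² : ∀ n j → 4 * (n * j) ≤ 4 * (j * j) + n * n
4nj≤4j²+n² n j with ≤-total n (2 * j)
... | inj₁ n≤ = via n (2 * j ∸ n) (m+[n∸m]≡n n≤)
  where
  via : ∀ n d → n + d ≡ 2 * j → 4 * (n * j) ≤ 4 * (j * j) + n * n
  via n d e = begin
    4 * (n * j)                          ≡⟨ l₁ n j ⟩
    2 * (n * (2 * j))                    ≡⟨ cong (λ x → 2 * (n * x)) e ⟨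
    2 * (n * (n + d))                    ≤⟨ m≤m+n _ (d * d) ⟩
    2 * (n * (n + d)) + d * d            ≡⟨ l₂ n d ⟩
    (n + d) * (n + d) + n * n            ≡⟨ cong (λ x → x * x + n * n) e ⟩
    2 * j * (2 * j) + n * n              ≡⟨ l₃ n j ⟩
    4 * (j * j) + n * n ∎
    where
    open ≤-Reasoning
    l₁ : ∀ n j → 4 * (n * j) ≡ 2 * (n * (2 * j))
    l₁ = solve-∀
    l₂ : ∀ n d → 2 * (n * (n + d)) + d * d ≡ (n + d) * (n + d) + n * n
    l₂ = solve-∀
    l₃ : ∀ n j → 2 * j * (2 * j) + n * n ≡ 4 * (j * j) + n * n
    l₃ = solve-∀
... | inj₂ 2j≤ = subst (λ n → 4 * (n * j) ≤ 4 * (j * j) + n * n) (m+[n∸m]≡n 2j≤) (via (n ∸ 2 * j))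
  where
  via : ∀ d → 4 * ((2 * j + d) * j) ≤ 4 * (j * j) + (2 * j + d) * (2 * j + d)
  via d = ≤-trans (m≤m+n _ (d * d)) (≤-reflexive (l j d))
    where
    l : ∀ j d → 4 * ((2 * j + d) * j) + d * d ≡ 4 * (j * j) + (2 * j + d) * (2 * j + d)
    l = solve-∀

fubini-suc : ∀ n → fubini (suc n) ≡ moment (λ j → suc (2 * j)) n
fubini-suc n = trans (sumℕ≤-cong (suc n) (λ j → sym (*-identityˡ (surj (suc n) j))))
  (trans (moment-suc (λ _ → 1) n) (sumℕ≤-cong n (λ j → cong (_* surj n j) (l j))))
  where
  l : ∀ j → j * 1 + suc j * 1 ≡ suc (2 * j)
  l = solve-∀

-- A uniformly random surjection from an n-set has mean image size at least n/2;
-- the induction step replaces the second moment by 4j² ≥ 4nj − n².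
first-moment : ∀ n → n * fubini n ≤ 2 * moment id n
first-moment zero    = z≤n
first-moment (suc n) = *-cancelˡ-≤ 2 (+-cancelˡ-≤ (2 * (n * n) * F) _ _ final)
  where
  open ≤-Reasoning
  F G : ℕ
  F = fubini n
  G = moment id n
  G≡ : moment id (suc n) ≡ moment (λ j → 2 * (j * j) + 2 * j + 1) n
  G≡ = trans (moment-suc id n) (sumℕ≤-cong n (λ j → cong (_* surj n j) (l j)))
    where
    l : ∀ j → j * j + suc j * suc j ≡ 2 * (j * j) + 2 * j + 1
    l = solve-∀
  F≡ : fubini (suc n) ≡ 2 * G + F
  F≡ = trans (fubini-suc n) (trans (sumℕ≤-cong n (λ j → l j (surj n j)))
    (trans (sumℕ≤-+ n _ _) (cong (_+ F) (sumℕ≤-* n 2 _))))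
    where
    l : ∀ j s → suc (2 * j) * s ≡ 2 * (j * s) + s
    l = solve-∀
  -- The bound 8j² ≥ 8nj - 2n², averaged over j. Its negative part becomes `2 * (n * n) * F` on the
  -- larger side and is cancelled at the end.
  expand : (8 * n + 8) * G + 4 * F ≤ 2 * (n * n) * F + 2 * (2 * moment id (suc n))
  expand = begin
    (8 * n + 8) * G + 4 * F
      ≡⟨ cong₂ _+_ (sym (sumℕ≤-* n (8 * n + 8) _)) (sym (sumℕ≤-* n 4 _)) ⟩
    sumℕ≤ n (λ j → (8 * n + 8) * (j * surj n j)) + sumℕ≤ n (λ j → 4 * surj n j)
      ≡⟨ sumℕ≤-+ n _ _ ⟨
    sumℕ≤ n (λ j → (8 * n + 8) * (j * surj n j) + 4 * surj n j)
      ≤⟨ sumℕ≤-mono n (λ j → term j (surj n j)) ⟩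
    sumℕ≤ n (λ j → 2 * (n * n) * surj n j + 4 * ((2 * (j * j) + 2 * j + 1) * surj n j))
      ≡⟨ sumℕ≤-+ n _ _ ⟩
    sumℕ≤ n (λ j → 2 * (n * n) * surj n j) + sumℕ≤ n (λ j → 4 * ((2 * (j * j) + 2 * j + 1) * surj n j))
      ≡⟨ cong₂ _+_ (sumℕ≤-* n (2 * (n * n)) _) (sumℕ≤-* n 4 _) ⟩
    2 * (n * n) * F + 4 * moment (λ j → 2 * (j * j) + 2 * j + 1) n
      ≡⟨ cong (λ x → 2 * (n * n) * F + 4 * x) G≡ ⟨
    2 * (n * n) * F + 4 * moment id (suc n)
      ≡⟨ cong (2 * (n * n) * F +_) (*-assoc 2 2 (moment id (suc n))) ⟩
    2 * (n * n) * F + 2 * (2 * moment id (suc n)) ∎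
    where
    term : ∀ j s → (8 * n + 8) * (j * s) + 4 * s ≤ 2 * (n * n) * s + 4 * ((2 * (j * j) + 2 * j + 1) * s)
    term j s = begin
      (8 * n + 8) * (j * s) + 4 * s                                   ≡⟨ l₁ n j s ⟩
      2 * (4 * (n * j)) * s + (8 * j + 4) * s                         ≤⟨ +-monoˡ-≤ _ (*-monoˡ-≤ s (*-monoʳ-≤ 2 (4nj≤4j²+n² n j))) ⟩
      2 * (4 * (j * j) + n * n) * s + (8 * j + 4) * s                 ≡⟨ l₂ n j s ⟩
      2 * (n * n) * s + 4 * ((2 * (j * j) + 2 * j + 1) * s) ∎
      where
      l₁ : ∀ n j s → (8 * n + 8) * (j * s) + 4 * s ≡ 2 * (4 * (n * j)) * s + (8 * j + 4) * s
      l₁ = solve-∀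
      l₂ : ∀ n j s → 2 * (4 * (j * j) + n * n) * s + (8 * j + 4) * s ≡ 2 * (n * n) * s + 4 * ((2 * (j * j) + 2 * j + 1) * s)
      l₂ = solve-∀
  final : 2 * (n * n) * F + 2 * (suc n * fubini (suc n)) ≤ 2 * (n * n) * F + 2 * (2 * moment id (suc n))
  final = begin
    2 * (n * n) * F + 2 * (suc n * fubini (suc n))          ≡⟨ cong (λ x → 2 * (n * n) * F + 2 * (suc n * x)) F≡ ⟩
    2 * (n * n) * F + 2 * (suc n * (2 * G + F))             ≡⟨ l₁ n F G ⟩
    2 * (suc n * (n * F)) + (4 * (suc n * G) + 2 * F)       ≤⟨ +-monoˡ-≤ _ (*-monoʳ-≤ 2 (*-monoʳ-≤ (suc n) (first-moment n))) ⟩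
    2 * (suc n * (2 * G)) + (4 * (suc n * G) + 2 * F)       ≤⟨ m≤m+n _ (2 * F) ⟩
    2 * (suc n * (2 * G)) + (4 * (suc n * G) + 2 * F) + 2 * F ≡⟨ l₂ n F G ⟩
    (8 * n + 8) * G + 4 * F                                 ≤⟨ expand ⟩
    2 * (n * n) * F + 2 * (2 * moment id (suc n)) ∎
    where
    l₁ : ∀ n F G → 2 * (n * n) * F + 2 * (suc n * (2 * G + F)) ≡ 2 * (suc n * (n * F)) + (4 * (suc n * G) + 2 * F)
    l₁ = solve-∀
    l₂ : ∀ n F G → 2 * (suc n * (2 * G)) + (4 * (suc n * G) + 2 * F) + 2 * F ≡ (8 * n + 8) * G + 4 * F
    l₂ = solve-∀

-- A new element fits into a preorder with j blocks in 2j + 1 ways, and by `first-moment` the mean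
-- of 2j is at least n. In the count for sets this pays for the choice of a twin.
fubini-growth : ∀ n → suc n * fubini n ≤ fubini (suc n)
fubini-growth n = begin
  suc n * fubini n                        ≡⟨ +-comm (fubini n) (n * fubini n) ⟩
  n * fubini n + fubini n                 ≤⟨ +-monoˡ-≤ (fubini n) (first-moment n) ⟩
  2 * moment id n + fubini n              ≡⟨ cong (_+ fubini n) (sumℕ≤-* n 2 _) ⟨
  sumℕ≤ n (λ j → 2 * (j * surj n j)) + fubini n ≡⟨ sumℕ≤-+ n _ _ ⟨
  sumℕ≤ n (λ j → 2 * (j * surj n j) + surj n j) ≡⟨ sumℕ≤-cong n (λ j → l j (surj n j)) ⟩
  moment (λ j → suc (2 * j)) n            ≡⟨ fubini-suc n ⟨
  fubini (suc n) ∎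
  where
  open ≤-Reasoning
  l : ∀ j s → 2 * (j * s) + s ≡ suc (2 * j) * s
  l = solve-∀

-- Counting recolourings of a set of vertices

module _ {A : Set} (_≟ᴬ_ : (x y : A) → Dec (x ≡ y)) where

  remove : A → List A → List A
  remove x = filter (¬? ∘ (x ≟ᴬ_))

  length-remove : ∀ {x xs} → Unique xs → x ∈ₗ xs → suc (length (remove x xs)) ≡ length xs
  length-remove {x} {.x ∷ xs} (x∉ ∷ u) (here refl) =
    cong suc (cong length (trans (filter-reject (¬? ∘ (x ≟ᴬ_)) (λ ¬r → ¬r refl))
                                 (filter-all (¬? ∘ (x ≟ᴬ_)) x∉)))
  length-remove {x} {y ∷ xs} (y∉ ∷ u) (there x∈) =
    trans (cong (suc ∘ length) (filter-accept (¬? ∘ (x ≟ᴬ_)) (λ x≡y → All.lookup y∉ x∈ (sym x≡y))))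
          (cong suc (length-remove u x∈))

infix 4 _⊆?_
_⊆?_ : (xs ys : List ℕ) → Dec (xs ⊆ ys)
xs ⊆? ys = Dec.map′ (λ a → All.lookup a) (λ s → All.tabulate s) (All.all? (ℕ∈._∈? ys) xs)

count : ℕ → List ℕ → ℕ
count c l = length (filter (c ≟_) l)

count-∷ : ∀ c x l → count c (x ∷ l) ≡ ind (c ≟ x) + count c l
count-∷ c x l with c ≟ x
... | yes p = cong length (filter-accept (c ≟_) p)
... | no ¬p = cong length (filter-reject (c ≟_) ¬p)

count-++ : ∀ c xs ys → count c (xs ++ ys) ≡ count c xs + count c ys
count-++ c xs ys = trans (cong length (filter-++ (c ≟_) xs ys)) (length-++ (filter (c ≟_) xs))

count-∉ : ∀ c l → c ∉ₗ l → count c l ≡ 0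
count-∉ c l c∉ = cong length (filter-none (c ≟_) (All.tabulate λ {x} x∈ e → c∉ (subst (_∈ₗ l) (sym e) x∈)))

count-∈ : ∀ {c l} → 0 < count c l → c ∈ₗ l
count-∈ {c} {l} h with c ℕ∈.∈? l
... | yes c∈ = c∈
... | no c∉  = contradiction (subst (0 <_) (count-∉ c l c∉) h) λ ()

SameBag : List ℕ → List ℕ → Set
SameBag W l = ∀ c → count c l ≡ count c W

sameBag? : ∀ W l → Dec (SameBag W l)
sameBag? W l = Dec.map′ extend (λ h → All.tabulate λ {c} _ → h c)
  (All.all? (λ c → count c l ≟ count c W) (l ++ W))
  where
  extend : All (λ c → count c l ≡ count c W) (l ++ W) → SameBag W l
  extend a c with c ℕ∈.∈? (l ++ W)
  ... | yes c∈ = All.lookup a c∈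
  ... | no  c∉ = trans (count-∉ c l (c∉ ∘ ∈-++⁺ˡ)) (sym (count-∉ c W (c∉ ∘ ∈-++⁺ʳ l)))

sameBag-tail : ∀ {x xs ys l} → SameBag (xs ++ x ∷ ys) (x ∷ l) → SameBag (xs ++ ys) l
sameBag-tail {x} {xs} {ys} {l} h c = +-cancelˡ-≡ (ind (c ≟ x)) _ _ (begin
  ind (c ≟ x) + count c l                     ≡⟨ count-∷ c x l ⟨
  count c (x ∷ l)                             ≡⟨ h c ⟩
  count c (xs ++ x ∷ ys)                      ≡⟨ count-++ c xs (x ∷ ys) ⟩
  count c xs + count c (x ∷ ys)               ≡⟨ cong (count c xs +_) (count-∷ c x ys) ⟩
  count c xs + (ind (c ≟ x) + count c ys)     ≡⟨ swapl (count c xs) (ind (c ≟ x)) _ ⟩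
  ind (c ≟ x) + (count c xs + count c ys)     ≡⟨ cong (ind (c ≟ x) +_) (count-++ c xs ys) ⟨
  ind (c ≟ x) + count c (xs ++ ys) ∎)
  where
  open ≡-Reasoning
  swapl : ∀ a b c → a + (b + c) ≡ b + (a + c)
  swapl = solve-∀

-- With Y the colours that are present anyway, this says that the colours l
-- complete the colour set A.
Completes : List ℕ → List ℕ → List ℕ → Set
Completes Y A l = l ⊆ A ++ Y × A ⊆ l ++ Y

completes? : ∀ Y A l → Dec (Completes Y A l)
completes? Y A l = (l ⊆? A ++ Y) ×-dec (A ⊆? l ++ Y)

module Colouring {n R : ℕ} (col : Fin n → Fin R → ℕ) (col-inj : ∀ v {c d} → col v c ≡ col v d → c ≡ d) where

  open Coordinates {R} public

  colour : Vec (Fin R) n → Fin n → ℕ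
  colour φ x = col x (Vec.lookup φ x)

  -- Runs over the colour sequences available to `us` and forgets the vertices, which turns the
  -- counting of recolourings into a question on lists of numbers.
  ∑ˢ : List (Fin n) → (List ℕ → ℕ) → ℕ
  ∑ˢ []       F = F []
  ∑ˢ (u ∷ us) F = ∑ (allFin R) (λ c → ∑ˢ us (λ l → F (col u c ∷ l)))

  ∑ˢ-mono : ∀ us {F G} → (∀ l → F l ≤ G l) → ∑ˢ us F ≤ ∑ˢ us G
  ∑ˢ-mono []       h = h []
  ∑ˢ-mono (u ∷ us) h = ∑-mono (allFin R) (λ c _ → ∑ˢ-mono us (λ l → h (col u c ∷ l)))

  ∑ˢ-+ : ∀ us F G → ∑ˢ us (λ l → F l + G l) ≡ ∑ˢ us F + ∑ˢ us G
  ∑ˢ-+ []       F G = refl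
  ∑ˢ-+ (u ∷ us) F G = trans (∑-cong (allFin R) (λ c → ∑ˢ-+ us _ _)) (∑-+ (allFin R) _ _)

  ∑ˢ-zero : ∀ us {F} → (∀ l → F l ≡ 0) → ∑ˢ us F ≡ 0
  ∑ˢ-zero []       h = h []
  ∑ˢ-zero (u ∷ us) h = ∑-zero (allFin R) (λ c _ → ∑ˢ-zero us (λ l → h (col u c ∷ l)))

  -- All colours off `us` are those of `φ`, so the event can be replaced by a condition on the new
  -- colours. Uniqueness of `us` keeps a later vertex from overwriting an earlier choice.
  ∑ᶜˢ≤∑ˢ : ∀ {E : Vec (Fin R) n → Set} {D : List ℕ → Set} (E? : ∀ φ → Dec (E φ)) (D? : ∀ l → Dec (D l))
    {us} → Unique us → ∀ φ → (∀ ψ → AgreeOff us φ ψ → E ψ → D (map (colour ψ) us)) →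
    ∑ᶜˢ us (ind ∘ E?) φ ≤ ∑ˢ us (ind ∘ D?)
  ∑ᶜˢ≤∑ˢ E? D? {[]} [] φ h = ind-mono (E? φ) (D? []) (h φ (λ _ _ → refl))
  ∑ᶜˢ≤∑ˢ {E} {D} E? D? {u ∷ us} (u∉ ∷ uq) φ h = ∑-mono (allFin R) λ c _ →
    ∑ᶜˢ≤∑ˢ E? (λ l → D? (col u c ∷ l)) uq (φ [ u ]≔ c) λ ψ agr e →
      subst (λ d → D (col u d ∷ map (colour ψ) us))
            (trans (sym (agr u (λ u∈ → All.lookup u∉ u∈ refl))) (Vecₚ.lookup∘update u φ c))
            (h ψ (agreeOff-∷ {us = us} {φ} {ψ} agr) e)

  -- By `col-inj` every entry of `W` is the colour of at most one index `c`.
  ∑-colours : ∀ u W m {F : Fin R → ℕ} → (∀ c → col u c ∈ₗ W → F c ≤ m) →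
    (∀ c → col u c ∉ₗ W → F c ≡ 0) → ∑ (allFin R) F ≤ length W * m
  ∑-colours u W m {F} h h₀ = begin
    ∑ (allFin R) F                                              ≤⟨ ∑-mono (allFin R) (λ c _ → pointwise c) ⟩
    ∑ (allFin R) (λ c → ∑ W (λ w → m * ind (col u c ≟ w)))     ≡⟨ ∑-swap (allFin R) W _ ⟩
    ∑ W (λ w → ∑ (allFin R) (λ c → m * ind (col u c ≟ w)))     ≤⟨ ∑-mono W (λ w _ → once w) ⟩
    ∑ W (λ _ → m)                                               ≡⟨ ∑-const W m ⟩
    length W * m ∎
    where
    open ≤-Reasoning
    pointwise : ∀ c → F c ≤ ∑ W (λ w → m * ind (col u c ≟ w))
    pointwise c with col u c ℕ∈.∈? W
    ... | no  c∉ = ≤-trans (≤-reflexive (h₀ c c∉)) z≤n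
    ... | yes c∈ = ≤-trans (h c c∈) (≤-trans
            (≤-reflexive (sym (trans (cong (m *_) (ind-yes (col u c ≟ col u c) refl)) (*-identityʳ m))))
            (∑-term (λ w → m * ind (col u c ≟ w)) c∈))
    once : ∀ w → ∑ (allFin R) (λ c → m * ind (col u c ≟ w)) ≤ m
    once w = ≤-trans (≤-reflexive (∑-* (allFin R) m _)) (≤-trans
      (*-monoʳ-≤ m (∑-ind-unique (λ c → col u c ≟ w) (Uniqueₚ.allFin⁺ R) (λ p q → col-inj u (trans p (sym q)))))
      (≤-reflexive (*-identityʳ m)))

  -- The first vertex takes an entry of `W`, and the others have to realise `W` without one
  -- occurrence of it.
  sameBag-count : ∀ us W → length W ≡ length us → ∑ˢ us (ind ∘ sameBag? W) ≤ length us !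
  sameBag-count []       W _ = ind-≤ (sameBag? W []) (λ _ → ≤-refl)
  sameBag-count (u ∷ us) W e = ≤-trans
    (∑-colours u W (length us !) occurs absent) (≤-reflexive (cong (_* length us !) e))
    where
    occurs : ∀ c → col u c ∈ₗ W → ∑ˢ us (λ l → ind (sameBag? W (col u c ∷ l))) ≤ length us !
    occurs c c∈ with ∈-∃++ c∈
    ... | xs , ys , refl = ≤-trans
      (∑ˢ-mono us λ l → ind-mono (sameBag? W (col u c ∷ l)) (sameBag? (xs ++ ys) l) (sameBag-tail {xs = xs}))
      (sameBag-count us (xs ++ ys) (suc-injective (trans (cong suc (length-++ xs))
        (trans (sym (+-suc (length xs) (length ys))) (trans (sym (length-++ xs)) e)))))
    absent : ∀ c → col u c ∉ₗ W → ∑ˢ us (λ l → ind (sameBag? W (col u c ∷ l))) ≡ 0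
    absent c c∉ = ∑ˢ-zero us λ l → ind-no (sameBag? W (col u c ∷ l)) λ s →
      c∉ (count-∈ (subst (0 <_) (trans (sym (trans (count-∷ _ _ l) (cong (_+ count (col u c) l) (ind-yes (col u c ≟ col u c) refl)))) (s (col u c))) (s≤s z≤n)))

  -- Follows the recurrence of `surj`: once the first vertex has colour `x`, the others attain
  -- either all of `A` or exactly `A` without `x`.
  surjection-count : ∀ us {A} → Unique A →
    ∑ˢ us (ind ∘ completes? [] A) ≤ surj (length us) (length A)
  surjection-count [] {[]}    _ = ind-≤ (completes? [] [] []) (λ _ → ≤-refl)
  surjection-count [] {a ∷ A} _ = ≤-trans
    (≤-reflexive (ind-no (completes? [] (a ∷ A) []) λ s → contradiction (proj₂ s (here refl)) λ ())) z≤n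
  surjection-count (u ∷ us) {A} uqA = ≤-trans
    -- `ℕ.pred (length A)` is the size of `A` without the first colour; if `A` is empty, its value
    -- is multiplied by `length A`, which is zero.
    (∑-colours u A (surj (length us) (length A) + surj (length us) (ℕ.pred (length A))) occurs absent)
    (≤-reflexive (recurrence A))
    where
    recurrence : ∀ A → length A * (surj (length us) (length A) + surj (length us) (ℕ.pred (length A)))
      ≡ surj (suc (length us)) (length A)
    recurrence []      = refl
    recurrence (_ ∷ A) = sym (surj-suc (length us) (length A))
    absent : ∀ c → col u c ∉ₗ A → ∑ˢ us (λ l → ind (completes? [] A (col u c ∷ l))) ≡ 0
    absent c c∉ = ∑ˢ-zero us λ l → ind-no (completes? [] A (col u c ∷ l)) λ s →
      [ c∉ , (λ ()) ]′ (∈-++⁻ A (proj₁ s (here refl)))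
    occurs : ∀ c → col u c ∈ₗ A → ∑ˢ us (λ l → ind (completes? [] A (col u c ∷ l)))
      ≤ surj (length us) (length A) + surj (length us) (ℕ.pred (length A))
    occurs c c∈ = begin
      ∑ˢ us (λ l → ind (completes? [] A (x ∷ l)))
        ≤⟨ ∑ˢ-mono us (λ l → ind-⊎ (completes? [] A (x ∷ l)) (completes? [] A l) (completes? [] A′ l) (split l)) ⟩
      ∑ˢ us (λ l → ind (completes? [] A l) + ind (completes? [] A′ l))
        ≡⟨ ∑ˢ-+ us _ _ ⟩
      ∑ˢ us (ind ∘ completes? [] A) + ∑ˢ us (ind ∘ completes? [] A′)
        ≤⟨ +-mono-≤ (surjection-count us uqA) (surjection-count us (Uniqueₚ.filter⁺ (¬? ∘ (x ≟_)) uqA)) ⟩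
      surj (length us) (length A) + surj (length us) (length A′)
        ≡⟨ cong (λ i → surj (length us) (length A) + surj (length us) i) (cong ℕ.pred (length-remove _≟_ uqA c∈)) ⟩
      surj (length us) (length A) + surj (length us) (ℕ.pred (length A)) ∎
      where
      open ≤-Reasoning
      x : ℕ
      x = col u c
      A′ : List ℕ
      A′ = remove _≟_ x A
      strip : ∀ {z} l → z ∈ₗ l ++ [] → z ∈ₗ l
      strip l z∈ = [ id , (λ ()) ]′ (∈-++⁻ l z∈)
      split : ∀ l → Completes [] A (x ∷ l) → Completes [] A l ⊎ Completes [] A′ l
      split l (s , t) with x ℕ∈.∈? l
      ... | yes x∈ = inj₁ (s ∘ there , λ z∈ → ∈-++⁺ˡ (back z∈))
        where
        back : ∀ {z} → z ∈ₗ A → z ∈ₗ l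
        back z∈ with strip (x ∷ l) (t z∈)
        ... | here refl = x∈
        ... | there z∈l = z∈l
      ... | no x∉ = inj₂ ( (λ z∈ → ∈-++⁺ˡ (∈-filter⁺ (¬? ∘ (x ≟_)) (strip A (s (there z∈))) λ { refl → x∉ z∈ }))
                         , (λ z∈ → ∈-++⁺ˡ (back z∈)))
        where
        back : ∀ {z} → z ∈ₗ A′ → z ∈ₗ l
        back z∈ with ∈-filter⁻ (¬? ∘ (x ≟_)) {xs = A} z∈
        ... | z∈A , x≢z with strip (x ∷ l) (t z∈A)
        ...   | here refl = ⊥-elim (x≢z refl)
        ...   | there z∈l = z∈l

  completion-count : ∀ Y us A → ∑ˢ us (ind ∘ completes? Y A) ≤ 2 ^ length Y * fubini (length us)
  completion-count [] us A = begin
    ∑ˢ us (ind ∘ completes? [] A)       ≤⟨ ∑ˢ-mono us (λ l → ind-mono (completes? [] A l) (completes? [] A′ l) dedup) ⟩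
    ∑ˢ us (ind ∘ completes? [] A′)      ≤⟨ surjection-count us (deduplicate-! A) ⟩
    surj (length us) (length A′)        ≤⟨ surj≤fubini (length us) (length A′) ⟩
    fubini (length us)                  ≡⟨ *-identityˡ _ ⟨
    1 * fubini (length us) ∎
    where
    open ≤-Reasoning
    A′ : List ℕ
    A′ = deduplicate _≟_ A
    dedup : ∀ {l} → Completes [] A l → Completes [] A′ l
    dedup (s , t) = (λ z∈ → ∈-++⁺ˡ (∈-deduplicate⁺ _≟_ ([ id , (λ ()) ]′ (∈-++⁻ A (s z∈)))))
                  , (λ z∈ → t (∈-deduplicate⁻ _≟_ A z∈))
  completion-count (z ∷ Y) us A = begin
    ∑ˢ us (ind ∘ completes? (z ∷ Y) A)
      ≤⟨ ∑ˢ-mono us (λ l → ind-⊎ (completes? (z ∷ Y) A l) (completes? Y (z ∷ A) l) (completes? Y (remove _≟_ z A) l) split) ⟩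
    ∑ˢ us (λ l → ind (completes? Y (z ∷ A) l) + ind (completes? Y (remove _≟_ z A) l))
      ≡⟨ ∑ˢ-+ us _ _ ⟩
    ∑ˢ us (ind ∘ completes? Y (z ∷ A)) + ∑ˢ us (ind ∘ completes? Y (remove _≟_ z A))
      ≤⟨ +-mono-≤ (completion-count Y us (z ∷ A)) (completion-count Y us (remove _≟_ z A)) ⟩
    2 ^ length Y * fubini (length us) + 2 ^ length Y * fubini (length us)
      ≡⟨ double (2 ^ length Y) _ ⟩
    2 * 2 ^ length Y * fubini (length us) ∎
    where
    open ≤-Reasoning
    double : ∀ a b → a * b + a * b ≡ 2 * a * b
    double = solve-∀
    split : ∀ {l} → Completes (z ∷ Y) A l → Completes Y (z ∷ A) l ⊎ Completes Y (remove _≟_ z A) l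
    split {l} (s , t) with z ℕ∈.∈? l
    ... | yes z∈l = inj₁ (there-move , back)
      where
      there-move : l ⊆ z ∷ A ++ Y
      there-move x∈ with ∈-++⁻ A (s x∈)
      ... | inj₁ x∈A         = there (∈-++⁺ˡ x∈A)
      ... | inj₂ (here refl) = here refl
      ... | inj₂ (there x∈Y) = there (∈-++⁺ʳ A x∈Y)
      back : z ∷ A ⊆ l ++ Y
      back (here refl) = ∈-++⁺ˡ z∈l
      back (there x∈A) with ∈-++⁻ l (t x∈A)
      ... | inj₁ x∈l         = ∈-++⁺ˡ x∈l
      ... | inj₂ (here refl) = ∈-++⁺ˡ z∈l
      ... | inj₂ (there x∈Y) = ∈-++⁺ʳ l x∈Y
    ... | no z∉l = inj₂ (avoid , back)
      where
      avoid : l ⊆ remove _≟_ z A ++ Y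
      avoid x∈ with ∈-++⁻ A (s x∈)
      ... | inj₁ x∈A         = ∈-++⁺ˡ (∈-filter⁺ (¬? ∘ (z ≟_)) x∈A λ { refl → z∉l x∈ })
      ... | inj₂ (here refl) = ⊥-elim (z∉l x∈)
      ... | inj₂ (there x∈Y) = ∈-++⁺ʳ (remove _≟_ z A) x∈Y
      back : remove _≟_ z A ⊆ l ++ Y
      back x∈ with ∈-filter⁻ (¬? ∘ (z ≟_)) {xs = A} x∈
      ... | x∈A , z≢x with ∈-++⁻ l (t x∈A)
      ...   | inj₁ x∈l         = ∈-++⁺ˡ x∈l
      ...   | inj₂ (here refl) = ⊥-elim (z≢x refl)
      ...   | inj₂ (there x∈Y) = ∈-++⁺ʳ l x∈Y

-- The growth of the number of good colourings

^-distribʳ-* : ∀ j a b → (a * b) ^ j ≡ a ^ j * b ^ j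
^-distribʳ-* zero    a b = refl
^-distribʳ-* (suc j) a b = trans (cong (a * b *_) (^-distribʳ-* j a b)) (*-interchange a b (a ^ j) (b ^ j))

module Growth {n R : ℕ} .{{_ : NonZero R}}
  (good : List (Fin n) → Vec (Fin R) n → Set) (good? : ∀ S φ → Dec (good S φ))
  (good-⊆ : ∀ {S S′ φ} → S ⊆ S′ → good S′ φ → good S φ)
  (good-local : ∀ {S φ ψ} → (∀ x → x ∈ₗ S → Vec.lookup φ x ≡ Vec.lookup ψ x) → good S φ → good S ψ)
  (M B : ℕ)
  where

  open Coordinates {R}

  -- N counts colourings of all n vertices, so R * N (v ∷ S) / N S is the factor by
  -- which the number of good partial colourings grows when v is added to S.
  N : List (Fin n) → ℕ
  N S = total (ind ∘ good? S)

  N-anti : ∀ {S S′} → S ⊆ S′ → N S′ ≤ N S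
  N-anti {S} {S′} S⊆S′ = ∑-mono (vectors n) (λ φ _ → ind-mono (good? S′ φ) (good? S φ) (good-⊆ S⊆S′))

  Grows : List (Fin n) → Fin n → Set
  Grows S v = B * N S ≤ M * R * N (v ∷ S)

  -- `Grows` is telescoped over `us`: after each removal the list is shorter than `s`, where growth
  -- is already known. Lists stand for sets here, so the relation of `S`, `us` and `S′` is a
  -- covering and not an equation.
  shrink : ∀ s → (∀ S v → length S < s → v ∉ₗ S → Grows S v) →
    ∀ {us} S S′ → Unique us → us ⊆ S → length S ≤ s → (∀ {x} → x ∈ₗ S → x ∈ₗ us ⊎ x ∈ₗ S′) →
    B ^ length us * N S′ ≤ (M * R) ^ length us * N S
  shrink s grow {[]} S S′ _ _ _ cov =
    *-monoʳ-≤ 1 (N-anti (λ x∈ → [ (λ ()) , id ]′ (cov x∈)))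
  shrink s grow {u ∷ us} S S′ (u∉ ∷ uq) us⊆S S≤s cov = begin
    B * B ^ length us * N S′                        ≡⟨ *-assoc B _ _ ⟩
    B * (B ^ length us * N S′)                      ≤⟨ *-monoʳ-≤ B (shrink s grow S₁ S′ uq us⊆S₁ (<⇒≤ S₁<s) cov₁) ⟩
    B * ((M * R) ^ length us * N S₁)                ≡⟨ *-leftComm B ((M * R) ^ length us) _ ⟩
    (M * R) ^ length us * (B * N S₁)                ≤⟨ *-monoʳ-≤ ((M * R) ^ length us) (grow S₁ u S₁<s u∉S₁) ⟩
    (M * R) ^ length us * (M * R * N (u ∷ S₁))      ≤⟨ *-monoʳ-≤ ((M * R) ^ length us) (*-monoʳ-≤ (M * R) (N-anti S⊆)) ⟩
    (M * R) ^ length us * (M * R * N S)             ≡⟨ *-leftComm ((M * R) ^ length us) (M * R) _ ⟩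
    M * R * ((M * R) ^ length us * N S)             ≡⟨ *-assoc (M * R) _ _ ⟨
    (M * R) ^ length (u ∷ us) * N S ∎
    where
    open ≤-Reasoning
    S₁ : List (Fin n)
    S₁ = remove Fin._≟_ u S
    S₁<s : length S₁ < s
    S₁<s = <-≤-trans (filter-notAll (¬? ∘ (u Fin.≟_)) S (Any.map (λ e ne → ne e) (us⊆S (here refl)))) S≤s
    u∉S₁ : u ∉ₗ S₁
    u∉S₁ u∈ = proj₂ (∈-filter⁻ (¬? ∘ (u Fin.≟_)) {xs = S} u∈) refl
    us⊆S₁ : us ⊆ S₁
    us⊆S₁ x∈ = ∈-filter⁺ (¬? ∘ (u Fin.≟_)) (us⊆S (there x∈)) (All.lookup u∉ x∈)
    S⊆ : S ⊆ u ∷ S₁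
    S⊆ {x} x∈ with u Fin.≟ x
    ... | yes refl = here refl
    ... | no u≢x   = there (∈-filter⁺ (¬? ∘ (u Fin.≟_)) x∈ u≢x)
    cov₁ : ∀ {x} → x ∈ₗ S₁ → x ∈ₗ us ⊎ x ∈ₗ S′
    cov₁ x∈ with ∈-filter⁻ (¬? ∘ (u Fin.≟_)) {xs = S} x∈
    ... | x∈S , u≢x with cov x∈S
    ...   | inj₁ (here refl) = ⊥-elim (u≢x refl)
    ...   | inj₁ (there x∈us) = inj₁ x∈us
    ...   | inj₂ x∈S′ = inj₂ x∈S′

  Controlled : List (Fin n) → ℕ → ℕ → ℕ → Set
  Controlled S j x m = R * B ^ j * x ≤ m * (M ^ j * N S)

  -- Uncolouring us removes j vertices of S, which by the growth of N costs at most
  -- a factor (M / B) ^ j; the remaining factor R is that of the new vertex v.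
  ControlRule : List (Fin n) → Fin n → Set₁
  ControlRule S v = ∀ {E : Vec (Fin R) n → Set} (E? : ∀ φ → Dec (E φ)) {us} j m →
    length us ≡ suc j → Unique us → v ∈ₗ us → us ⊆ v ∷ S → (∀ φ → E φ → good S φ) →
    (∀ φ → ∑ᶜˢ us (ind ∘ E?) φ ≤ m) → Controlled S j (total (ind ∘ E?)) m

  -- Recolouring `us` preserves goodness on `S` without `us`; `total-uncolour` compares the event
  -- with that smaller set and `shrink` leads back to `S`.
  controlRule : ∀ s → (∀ S v → length S < s → v ∉ₗ S → Grows S v) →
    ∀ S v → length S ≤ s → v ∉ₗ S → ControlRule S v
  controlRule s grow S v S≤s v∉S {E} E? {us} j m len uq v∈us us⊆ E⇒good bound =
    -- Uncolouring yields a factor `R` for each of the `suc j` vertices, but only `j` of them lie in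
    -- `S` and use up theirs in `shrink`. The one of `v` survives.
    *-cancelˡ-≤ (R ^ j) {{m^n≢0 R j}} (begin
    R ^ j * (R * B ^ j * t)                 ≡⟨ l₁ (R ^ j) R (B ^ j) t ⟩
    B ^ j * (R * R ^ j * t)                 ≡⟨ cong (λ i → B ^ j * (R ^ i * t)) (sym len) ⟩
    B ^ j * (R ^ length us * t)             ≤⟨ *-monoʳ-≤ (B ^ j) (total-uncolour E? (good? S′) us m localised bound) ⟩
    B ^ j * (m * N S′)                      ≡⟨ *-leftComm (B ^ j) m _ ⟩
    m * (B ^ j * N S′)                      ≤⟨ *-monoʳ-≤ m shrunk ⟩
    m * ((M * R) ^ j * N S)                 ≡⟨ cong (λ x → m * (x * N S)) (^-distribʳ-* j M R) ⟩
    m * (M ^ j * R ^ j * N S)               ≡⟨ l₂ m (M ^ j) (R ^ j) (N S) ⟩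
    R ^ j * (m * (M ^ j * N S)) ∎)
    where
    open ≤-Reasoning
    open import Data.List.Membership.DecPropositional (Fin._≟_ {n}) using () renaming (_∈?_ to _∈ᶠ?_)
    t : ℕ
    t = total (ind ∘ E?)
    l₁ : ∀ a b c d → a * (b * c * d) ≡ c * (b * a * d)
    l₁ = solve-∀
    l₂ : ∀ a b c d → a * (b * c * d) ≡ c * (a * (b * d))
    l₂ = solve-∀
    ∉us? : ∀ x → Dec (x ∉ₗ us)
    ∉us? x = ¬? (x ∈ᶠ? us)
    S′ us′ : List (Fin n)
    S′ = filter ∉us? S
    us′ = remove Fin._≟_ v us
    len′ : length us′ ≡ j
    len′ = suc-injective (trans (length-remove Fin._≟_ uq v∈us) len)
    us′⊆S : us′ ⊆ S
    us′⊆S x∈ with ∈-filter⁻ (¬? ∘ (v Fin.≟_)) {xs = us} x∈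
    ... | x∈us , v≢x with us⊆ x∈us
    ...   | here refl = ⊥-elim (v≢x refl)
    ...   | there x∈S = x∈S
    cov : ∀ {x} → x ∈ₗ S → x ∈ₗ us′ ⊎ x ∈ₗ S′
    cov {x} x∈S with x ∈ᶠ? us
    ... | yes x∈us = inj₁ (∈-filter⁺ (¬? ∘ (v Fin.≟_)) x∈us λ { refl → v∉S x∈S })
    ... | no  x∉us = inj₂ (∈-filter⁺ ∉us? x∈S x∉us)
    shrunk : B ^ j * N S′ ≤ (M * R) ^ j * N S
    shrunk = subst (λ i → B ^ i * N S′ ≤ (M * R) ^ i * N S) len′
      (shrink s grow S S′ (Uniqueₚ.filter⁺ (¬? ∘ (v Fin.≟_)) uq) us′⊆S S≤s cov)
    localised : ∀ φ ψ → AgreeOff us φ ψ → E ψ → good S′ φ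
    localised φ ψ agr e = good-local (λ x x∈ → sym (agr x (proj₂ (∈-filter⁻ ∉us? {xs = S} x∈))))
      (good-⊆ (λ x∈ → proj₁ (∈-filter⁻ ∉us? {xs = S} x∈)) (E⇒good ψ e))

  module _ (step : ∀ S v → v ∉ₗ S → ControlRule S v → Grows S v) where

    -- Induction on the length of `S`: uncolouring appeals only to growth at strictly shorter lists.
    grows : ∀ S v → v ∉ₗ S → Grows S v
    grows S v = below (suc (length S)) S v ≤-refl
      where
      below : ∀ s S v → length S < s → v ∉ₗ S → Grows S v
      below (suc s) S v (s≤s S≤s) v∉S = step S v v∉S (controlRule s (below s) S v S≤s v∉S)

    N-pos : 0 < B → 0 < N [] → ∀ {S} → Unique S → 0 < N S
    N-pos B>0 base []                 = base
    N-pos B>0 base {v ∷ S} (v∉ ∷ uq) = n≢0⇒n>0 λ N≡0 → <⇒≢ (*-mono-< B>0 (N-pos B>0 base uq))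
      (sym (n≤0⇒n≡0 (≤-trans (grows S v (λ v∈ → All.lookup v∉ v∈ refl))
        (≤-reflexive (trans (cong (M * R *_) N≡0) (*-zeroʳ (M * R)))))))

  -- The bad extensions of kind `i` amount to at most `t i * a / (M * R)`, and `slack` is β + Σ t_i
  -- / M ≤ R multiplied by `M`. Subtracting the losses leaves the factor `B`.
  growth-step : ∀ {A : Set} (is : List A) (bad t : A → ℕ) {a a′} → a ≤ a′ + ∑ is bad →
    (∀ i → i ∈ₗ is → M * R * bad i ≤ t i * a) → B + ∑ is t ≤ M * R → B * a ≤ M * R * a′
  growth-step is bad t {a} {a′} cover bounds slack = +-cancelʳ-≤ (∑ is t * a) _ _ (begin
    B * a + ∑ is t * a                            ≡⟨ *-distribʳ-+ a B _ ⟨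
    (B + ∑ is t) * a                              ≤⟨ *-mono-≤ slack cover ⟩
    M * R * (a′ + ∑ is bad)                       ≡⟨ *-distribˡ-+ (M * R) a′ _ ⟩
    M * R * a′ + M * R * ∑ is bad                 ≡⟨ cong (M * R * a′ +_) (∑-* is (M * R) bad) ⟨
    M * R * a′ + ∑ is (λ i → M * R * bad i)       ≤⟨ +-monoʳ-≤ (M * R * a′) (∑-mono is bounds) ⟩
    M * R * a′ + ∑ is (λ i → t i * a)             ≡⟨ cong (M * R * a′ +_) (trans (∑-cong is (λ i → *-comm (t i) a)) (trans (∑-* is a t) (*-comm a _))) ⟩
    M * R * a′ + ∑ is t * a ∎)
    where open ≤-Reasoning

  -- Here c = k − i, and num / c is the radicand in the i-th summand of the bound on R.
  controlled⇒bound : .{{_ : NonZero B}} → ∀ {S j x} c .{{_ : NonZero c}} num t {m} → Controlled S j x m →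
    c * m ≤ num → num * M ^ suc j ≤ t * B ^ j * c → M * R * x ≤ t * N S
  controlled⇒bound {S} {j} {x} c num t {m} ctrl cm≤ t≥ =
    *-cancelˡ-≤ (B ^ j * c) {{m*n≢0 (B ^ j) c {{m^n≢0 B j}}}} (begin
    B ^ j * c * (M * R * x)             ≡⟨ l₁ (B ^ j) c M R x ⟩
    M * c * (R * B ^ j * x)             ≤⟨ *-monoʳ-≤ (M * c) ctrl ⟩
    M * c * (m * (M ^ j * N S))         ≡⟨ l₂ M c m (M ^ j) (N S) ⟩
    c * m * (M * M ^ j) * N S           ≤⟨ *-monoˡ-≤ (N S) (*-monoˡ-≤ (M * M ^ j) cm≤) ⟩
    num * (M * M ^ j) * N S             ≤⟨ *-monoˡ-≤ (N S) t≥ ⟩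
    t * B ^ j * c * N S                 ≡⟨ l₃ t (B ^ j) c (N S) ⟩
    B ^ j * c * (t * N S) ∎)
    where
    open ≤-Reasoning
    l₁ : ∀ b c M R x → b * c * (M * R * x) ≡ M * c * (R * b * x)
    l₁ = solve-∀
    l₂ : ∀ M c m p N → M * c * (m * (p * N)) ≡ c * m * (M * p) * N
    l₂ = solve-∀
    l₃ : ∀ t b c N → t * b * c * N ≡ b * c * (t * N)
    l₃ = solve-∀

  Controlled-∑ : ∀ {A : Set} (xs : List A) {S j} {x m : A → ℕ} →
    (∀ y → y ∈ₗ xs → Controlled S j (x y) (m y)) → Controlled S j (∑ xs x) (∑ xs m)
  Controlled-∑ xs {S} {j} {x} {m} h = begin
    R * B ^ j * ∑ xs x                        ≡⟨ ∑-* xs (R * B ^ j) x ⟨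
    ∑ xs (λ y → R * B ^ j * x y)              ≤⟨ ∑-mono xs h ⟩
    ∑ xs (λ y → m y * (M ^ j * N S))          ≡⟨ trans (∑-cong xs (λ y → *-comm (m y) _)) (trans (∑-* xs (M ^ j * N S) m) (*-comm (M ^ j * N S) _)) ⟩
    ∑ xs m * (M ^ j * N S) ∎
    where open ≤-Reasoning

  Controlled-mono : ∀ {S j x x′ m m′} → x′ ≤ x → m ≤ m′ → Controlled S j x m → Controlled S j x′ m′
  Controlled-mono {S} {j} x≤ m≤ c =
    ≤-trans (*-monoʳ-≤ (R * B ^ j) x≤) (≤-trans c (*-monoˡ-≤ (M ^ j * N S) m≤))

  Controlled-zero : ∀ {S j x} m → x ≡ 0 → Controlled S j x m
  Controlled-zero {j = j} m refl = ≤-trans (≤-reflexive (*-zeroʳ (R * B ^ j))) z≤n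

-- Subsets and degrees

module _ {n : ℕ} where

  length-⊆ : ∀ {xs ys : List (Fin n)} → Unique xs → xs ⊆ ys → length xs ≤ length ys
  length-⊆ {[]}     {ys} _        _   = z≤n
  length-⊆ {x ∷ xs} {ys} (x∉ ∷ u) xs⊆ = ≤-<-trans
    (length-⊆ u (λ y∈ → ∈-filter⁺ (¬? ∘ (x Fin.≟_)) (xs⊆ (there y∈)) (All.lookup x∉ y∈)))
    (filter-notAll (¬? ∘ (x Fin.≟_)) ys (Any.map (λ e ne → ne e) (xs⊆ (here refl))))

  _≟ˢ_ : (P Q : Subset n) → Dec (P ≡ Q)
  _≟ˢ_ = Vecₚ.≡-dec Boolₚ._≟_

elems : ∀ {n} → Subset n → List (Fin n)
elems []            = []
elems (inside ∷ p)  = Fin.zero ∷ map Fin.suc (elems p)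
elems (outside ∷ p) = map Fin.suc (elems p)

∈-elems⁺ : ∀ {n} {p : Subset n} {x} → x ∈ p → x ∈ₗ elems p
∈-elems⁺ {p = inside  ∷ p} here       = here refl
∈-elems⁺ {p = inside  ∷ p} (there x∈) = there (∈-map⁺ Fin.suc (∈-elems⁺ x∈))
∈-elems⁺ {p = outside ∷ p} (there x∈) = ∈-map⁺ Fin.suc (∈-elems⁺ x∈)

∈-elems⁻ : ∀ {n} {p : Subset n} {x} → x ∈ₗ elems p → x ∈ p
∈-elems⁻ {p = inside ∷ p} (here refl) = here
∈-elems⁻ {p = inside ∷ p} (there x∈) with ∈-map⁻ Fin.suc x∈
... | _ , y∈ , refl = there (∈-elems⁻ y∈)
∈-elems⁻ {p = outside ∷ p} x∈ with ∈-map⁻ Fin.suc x∈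
... | _ , y∈ , refl = there (∈-elems⁻ y∈)

elems-unique : ∀ {n} (p : Subset n) → Unique (elems p)
elems-unique []            = []
elems-unique (inside ∷ p)  = All.tabulate fresh ∷ Uniqueₚ.map⁺ Finₚ.suc-injective (elems-unique p)
  where
  fresh : ∀ {x} → x ∈ₗ map Fin.suc (elems p) → Fin.zero ≢ x
  fresh x∈ refl with ∈-map⁻ Fin.suc x∈
  ... | _ , _ , ()
elems-unique (outside ∷ p) = Uniqueₚ.map⁺ Finₚ.suc-injective (elems-unique p)

length-elems : ∀ {n} (p : Subset n) → length (elems p) ≡ ∣ p ∣
length-elems []            = refl
length-elems (inside ∷ p)  = cong suc (trans (length-map Fin.suc (elems p)) (length-elems p))
length-elems (outside ∷ p) = trans (length-map Fin.suc (elems p)) (length-elems p)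

x∈p─q⇒x∉q : ∀ {n} (p q : Subset n) {x} → x ∈ p ─ q → x ∉ q
x∈p─q⇒x∉q (_ ∷ p) (inside  ∷ q) (there x∈) (there x∈q) = x∈p─q⇒x∉q p q x∈ x∈q
x∈p─q⇒x∉q (_ ∷ p) (outside ∷ q) (there x∈) (there x∈q) = x∈p─q⇒x∉q p q x∈ x∈q

∣p─q∣+∣p∩q∣≡∣p∣ : ∀ {n} (p q : Subset n) → ∣ p ─ q ∣ + ∣ p ∩ q ∣ ≡ ∣ p ∣
∣p─q∣+∣p∩q∣≡∣p∣ []            []            = refl
∣p─q∣+∣p∩q∣≡∣p∣ (inside  ∷ p) (inside  ∷ q) = trans (+-suc _ _) (cong suc (∣p─q∣+∣p∩q∣≡∣p∣ p q))
∣p─q∣+∣p∩q∣≡∣p∣ (inside  ∷ p) (outside ∷ q) = cong suc (∣p─q∣+∣p∩q∣≡∣p∣ p q)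
∣p─q∣+∣p∩q∣≡∣p∣ (outside ∷ p) (inside  ∷ q) = ∣p─q∣+∣p∩q∣≡∣p∣ p q
∣p─q∣+∣p∩q∣≡∣p∣ (outside ∷ p) (outside ∷ q) = ∣p─q∣+∣p∩q∣≡∣p∣ p q

∣p─q∣≡∣q─p∣ : ∀ {n} (p q : Subset n) → ∣ p ∣ ≡ ∣ q ∣ → ∣ p ─ q ∣ ≡ ∣ q ─ p ∣
∣p─q∣≡∣q─p∣ p q e = +-cancelʳ-≡ ∣ p ∩ q ∣ _ _ (trans (∣p─q∣+∣p∩q∣≡∣p∣ p q)
  (trans e (sym (trans (cong (λ r → ∣ q ─ p ∣ + ∣ r ∣) (∩-comm p q)) (∣p─q∣+∣p∩q∣≡∣p∣ q p)))))

─-empty⇒≡ : ∀ {n} (p q : Subset n) → ∣ p ─ q ∣ ≡ 0 → ∣ q ─ p ∣ ≡ 0 → p ≡ q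
─-empty⇒≡ []            []            _ _ = refl
─-empty⇒≡ (inside  ∷ p) (inside  ∷ q) a b = cong (inside ∷_) (─-empty⇒≡ p q a b)
─-empty⇒≡ (outside ∷ p) (outside ∷ q) a b = cong (outside ∷_) (─-empty⇒≡ p q a b)
─-empty⇒≡ (inside  ∷ p) (outside ∷ q) () b
─-empty⇒≡ (outside ∷ p) (inside  ∷ q) a ()

module Degrees {n k Δ : ℕ} (H : Hypergraph n) (uniform : Uniform k H) (maxDeg : MaxDegree≤ H Δ) where

  others : ℕ → Subset n → List (Subset n)
  others i P = filter (λ Q → ¬? (P ≟ˢ Q) ×-dec (∣ P ─ Q ∣ ≟ i)) (edges H)

  -- The edge `P` itself occupies one of the at most Δ places at `w`.
  others-through : ∀ {P w} → P ∈ₗ edges H → w ∈ P →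
    ∑ (edges H) (λ Q → ind (¬? (P ≟ˢ Q) ×-dec (w ∈? Q))) ≤ Δ ∸ 1
  others-through {P} {w} P∈ w∈P = m+n≤o⇒m≤o∸n _ (≤-trans (begin
    ∑ (edges H) (λ Q → ind (¬? (P ≟ˢ Q) ×-dec (w ∈? Q))) + 1
      ≤⟨ +-monoʳ-≤ _ (≤-trans (≤-reflexive (sym (ind-yes (P ≟ˢ P) refl))) (∑-term (λ Q → ind (P ≟ˢ Q)) P∈)) ⟩
    ∑ (edges H) (λ Q → ind (¬? (P ≟ˢ Q) ×-dec (w ∈? Q))) + ∑ (edges H) (λ Q → ind (P ≟ˢ Q))
      ≡⟨ ∑-+ (edges H) _ _ ⟨
    ∑ (edges H) (λ Q → ind (¬? (P ≟ˢ Q) ×-dec (w ∈? Q)) + ind (P ≟ˢ Q))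
      ≤⟨ ∑-mono (edges H) (λ Q _ → pointwise Q) ⟩
    ∑ (edges H) (λ Q → ind (w ∈? Q))
      ≡⟨ length-filter-∑ (w ∈?_) (edges H) ⟨
    deg H w ∎) (maxDeg w))
    where
    open ≤-Reasoning
    pointwise : ∀ Q → ind (¬? (P ≟ˢ Q) ×-dec (w ∈? Q)) + ind (P ≟ˢ Q) ≤ ind (w ∈? Q)
    pointwise Q with P ≟ˢ Q
    ... | yes refl = ≤-reflexive (sym (ind-yes (w ∈? Q) w∈P))
    ... | no P≢Q with w ∈? Q
    ...   | yes _ = ≤-refl
    ...   | no  _ = z≤n

  -- At most Δ - 1 other edges contain `v`. The estimate k - i ≤ k - 1 gives the same right-hand
  -- side as for the edges that avoid `v`.
  others-∋ : ∀ {P v} i → 1 ≤ i → P ∈ₗ edges H → v ∈ P →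
    (k ∸ i) * ∑ (others i P) (λ Q → ind (v ∈? Q)) ≤ (k ∸ 1) * (Δ ∸ 1)
  others-∋ {P} {v} i 1≤i P∈ v∈P = *-mono-≤ (∸-monoʳ-≤ k 1≤i) (≤-trans
    (∑-filter-≤ _ (edges H) λ Q (P≢Q , _) → ind-mono (v ∈? Q) (¬? (P ≟ˢ Q) ×-dec (v ∈? Q)) (P≢Q ,_))
    (others-through P∈ v∈P))

  -- Double counting of the triples w ∈ P ∩ Q: each such Q contains k − i of the
  -- k − 1 vertices w ≠ v of P.
  others-∌ : ∀ {P v} i → P ∈ₗ edges H → v ∈ P →
    (k ∸ i) * ∑ (others i P) (λ Q → ind (¬? (v ∈? Q))) ≤ (k ∸ 1) * (Δ ∸ 1)
  others-∌ {P} {v} i P∈ v∈P = begin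
    (k ∸ i) * ∑ (others i P) (λ Q → ind (¬? (v ∈? Q)))
      ≡⟨ ∑-* (others i P) (k ∸ i) _ ⟨
    ∑ (others i P) (λ Q → (k ∸ i) * ind (¬? (v ∈? Q)))
      ≤⟨ ∑-mono (others i P) (λ Q Q∈ → pointwise Q (proj₂ (proj₂ (∈-filter⁻ (λ Q → ¬? (P ≟ˢ Q) ×-dec (∣ P ─ Q ∣ ≟ i)) {xs = edges H} Q∈)))) ⟩
    ∑ (others i P) (λ Q → ∑ ws (λ w → ind (w ∈? Q)))
      ≤⟨ ∑-filter-≤ _ (edges H) (λ Q (P≢Q , _) → ∑-mono ws (λ w _ → ind-mono (w ∈? Q) (¬? (P ≟ˢ Q) ×-dec (w ∈? Q)) (P≢Q ,_))) ⟩
    ∑ (edges H) (λ Q → ∑ ws (λ w → ind (¬? (P ≟ˢ Q) ×-dec (w ∈? Q))))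
      ≡⟨ ∑-swap (edges H) ws _ ⟩
    ∑ ws (λ w → ∑ (edges H) (λ Q → ind (¬? (P ≟ˢ Q) ×-dec (w ∈? Q))))
      ≤⟨ ∑-mono ws (λ w w∈ → others-through P∈ (∈-elems⁻ (proj₁ (∈-filter⁻ (¬? ∘ (v Fin.≟_)) {xs = elems P} w∈)))) ⟩
    ∑ ws (λ _ → Δ ∸ 1)
      ≡⟨ ∑-const ws (Δ ∸ 1) ⟩
    length ws * (Δ ∸ 1)
      ≡⟨ cong (_* (Δ ∸ 1)) (cong (_∸ 1) (trans (length-remove Fin._≟_ (elems-unique P) (∈-elems⁺ v∈P)) (trans (length-elems P) (uniform P P∈)))) ⟩
    (k ∸ 1) * (Δ ∸ 1) ∎
    where
    open ≤-Reasoning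
    ws : List (Fin n)
    ws = remove Fin._≟_ v (elems P)
    pointwise : ∀ Q → ∣ P ─ Q ∣ ≡ i → (k ∸ i) * ind (¬? (v ∈? Q)) ≤ ∑ ws (λ w → ind (w ∈? Q))
    pointwise Q refl with v ∈? Q
    ... | yes v∈Q = ≤-trans (≤-reflexive (*-zeroʳ (k ∸ i))) z≤n
    ... | no v∉Q = begin
      (k ∸ i) * 1                            ≡⟨ *-identityʳ (k ∸ i) ⟩
      k ∸ i                                  ≡⟨ cong (_∸ i) (sym (trans (∣p─q∣+∣p∩q∣≡∣p∣ P Q) (uniform P P∈))) ⟩
      i + ∣ P ∩ Q ∣ ∸ i                      ≡⟨ m+n∸m≡n i _ ⟩
      ∣ P ∩ Q ∣                              ≡⟨ length-elems (P ∩ Q) ⟨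
      length (elems (P ∩ Q))                 ≤⟨ length-⊆ (elems-unique (P ∩ Q)) sub ⟩
      length (filter (_∈? Q) ws)             ≡⟨ length-filter-∑ (_∈? Q) ws ⟩
      ∑ ws (λ w → ind (w ∈? Q)) ∎
      where
      sub : elems (P ∩ Q) ⊆ filter (_∈? Q) ws
      sub x∈ with x∈p∩q⁻ P Q (∈-elems⁻ x∈)
      ... | x∈P , x∈Q = ∈-filter⁺ (_∈? Q) (∈-filter⁺ (¬? ∘ (v Fin.≟_)) (∈-elems⁺ x∈P) λ { refl → v∉Q x∈Q }) x∈Q

  ∣P─Q∣>0 : ∀ {P Q} → P ∈ₗ edges H → Q ∈ₗ edges H → P ≢ Q → 1 ≤ ∣ P ─ Q ∣
  ∣P─Q∣>0 {P} {Q} P∈ Q∈ P≢Q = n≢0⇒n>0 λ e → P≢Q (─-empty⇒≡ P Q e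
    (trans (sym (∣p─q∣≡∣q─p∣ P Q (trans (uniform P P∈) (sym (uniform Q Q∈))))) e))

  ∣P─Q∣<k : ∀ {P Q} → P ∈ₗ edges H → Intersect P Q → ∣ P ─ Q ∣ < k
  ∣P─Q∣<k {P} {Q} P∈ (x , x∈P , x∈Q) =
    subst (∣ P ─ Q ∣ <_) (uniform P P∈) (p∩q≢∅⇒∣p─q∣<∣p∣ P Q (x , x∈p∩q⁺ (x∈P , x∈Q)))

  inI? : ∀ i → 1 ≤ i → i ≤ k ∸ 1 → Dec (InI k H i)
  inI? i 1≤i i≤ = Dec.map′ to from
    (Any.any? (λ P → Any.any? (λ Q → ∣ P ─ Q ∣ ≟ i) (edges H)) (edges H))
    where
    to : Any (λ P → Any (λ Q → ∣ P ─ Q ∣ ≡ i) (edges H)) (edges H) → InI k H i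
    to a with find a
    ... | P , P∈ , b with find b
    ...   | Q , Q∈ , e = 1≤i , i≤ , P , Q , P∈ , Q∈ , e
    from : InI k H i → Any (λ P → Any (λ Q → ∣ P ─ Q ∣ ≡ i) (edges H)) (edges H)
    from (_ , _ , P , Q , P∈ , Q∈ , e) = lose P∈ (lose Q∈ e)

range : ℕ → List ℕ
range zero    = []
range (suc m) = suc m ∷ range m

∈-range⁻ : ∀ m {i} → i ∈ₗ range m → 1 ≤ i × i ≤ m
∈-range⁻ (suc m) (here refl) = s≤s z≤n , ≤-refl
∈-range⁻ (suc m) (there i∈)  with ∈-range⁻ m i∈
... | 1≤i , i≤m = 1≤i , m≤n⇒m≤1+n i≤m

∈-range⁺ : ∀ m {i} → 1 ≤ i → i ≤ m → i ∈ₗ range m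
∈-range⁺ zero    1≤i i≤0 = contradiction (≤-trans 1≤i i≤0) λ ()
∈-range⁺ (suc m) 1≤i i≤  with m≤n⇒m<n∨m≡n i≤
... | inj₁ (s≤s i≤m) = there (∈-range⁺ m 1≤i i≤m)
... | inj₂ refl      = here refl

-- From counts of conflicts to a good colouring of all vertices

module Uncolouring {n k Δ R : ℕ} .{{_ : NonZero R}} (H : Hypergraph n)
  (uniform : Uniform k H) (maxDeg : MaxDegree≤ H Δ)
  (good : List (Fin n) → Vec (Fin R) n → Set) (good? : ∀ S φ → Dec (good S φ))
  (good-⊆ : ∀ {S S′ φ} → S ⊆ S′ → good S′ φ → good S φ)
  (good-local : ∀ {S φ ψ} → (∀ x → x ∈ₗ S → Vec.lookup φ x ≡ Vec.lookup ψ x) → good S φ → good S ψ)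
  (M B : ℕ) .{{_ : NonZero B}}
  where

  open Coordinates {R}
  open Growth good good? good-⊆ good-local M B public
  open Degrees H uniform maxDeg

  -- The admissible number of conflicting recolourings for one pair of edges: `w₁` if `v` lies in P
  -- ─ Q, `w₂` if it lies in P ∩ Q.
  weight : (w₁ w₂ : ℕ) → Fin n → Subset n → ℕ
  weight w₁ w₂ v Q = w₁ * ind (¬? (v ∈? Q)) + w₂ * ind (v ∈? Q)

  weight-∌ : ∀ w₁ w₂ {v Q} → v ∉ Q → w₁ ≤ weight w₁ w₂ v Q
  weight-∌ w₁ w₂ {v} {Q} v∉Q = ≤-trans
    (≤-reflexive (sym (trans (cong (w₁ *_) (ind-yes (¬? (v ∈? Q)) v∉Q)) (*-identityʳ w₁)))) (m≤m+n _ _)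

  weight-∋ : ∀ w₁ w₂ {v Q} → v ∈ Q → w₂ ≤ weight w₁ w₂ v Q
  weight-∋ w₁ w₂ {v} {Q} v∈Q = ≤-trans
    (≤-reflexive (sym (trans (cong (w₂ *_) (ind-yes (v ∈? Q) v∈Q)) (*-identityʳ w₂)))) (m≤n+m _ _)

  -- The event E S v P Q is that colouring v creates a conflict of P ∋ v with Q.
  module _
    (E : List (Fin n) → Fin n → Subset n → Subset n → Vec (Fin R) n → Set)
    (E? : ∀ S v P Q φ → Dec (E S v P Q φ))
    (cover : ∀ {S v} φ → v ∉ₗ S → good S φ → ¬ good (v ∷ S) φ →
      ∃ λ P → ∃ λ Q → P ∈ₗ edges H × Q ∈ₗ edges H × P ≢ Q × Intersect P Q × v ∈ P × E S v P Q φ)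
    (w₁ w₂ : ℕ → ℕ)
    (control : ∀ {S v P Q j} → v ∉ₗ S → P ∈ₗ edges H → Q ∈ₗ edges H → v ∈ P → ∣ P ─ Q ∣ ≡ suc j →
      ControlRule S v → Controlled S j (total (ind ∘ E? S v P Q)) (weight (w₁ (suc j)) (w₂ (suc j)) v Q))
    (num t : ℕ → ℕ)
    (num≥ : ∀ i → Δ * ((k ∸ 1) * (Δ ∸ 1)) * (w₁ i + w₂ i) ≤ num i)
    (t≥ : ∀ i → 1 ≤ i → i ≤ k ∸ 1 → InI k H i → num i * M ^ i ≤ t i * B ^ (i ∸ 1) * (k ∸ i))
    (slack : B + ∑ (range (k ∸ 1)) t ≤ M * R)
    where

    bad : List (Fin n) → Fin n → ℕ → ℕ
    bad S v i = ∑ (edgesAt H v) (λ P → ∑ (others i P) (λ Q → total (ind ∘ E? S v P Q)))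

    -- A union bound. The pair causing a conflict has 1 ≤ |P ─ Q| ≤ k - 1, because its edges are
    -- distinct, of equal size and intersecting.
    N-cover : ∀ S v → v ∉ₗ S → N S ≤ N (v ∷ S) + ∑ (range (k ∸ 1)) (bad S v)
    N-cover S v v∉S = begin
      N S
        ≤⟨ ∑-mono (vectors n) (λ φ _ → ind-≤ (good? S φ) (pointwise φ)) ⟩
      total (λ φ → ind (good? (v ∷ S) φ) + conflicts φ)
        ≡⟨ ∑-+ (vectors n) _ _ ⟩
      N (v ∷ S) + total conflicts
        ≡⟨ cong (N (v ∷ S) +_) (∑-swap (vectors n) (range (k ∸ 1)) _) ⟩
      N (v ∷ S) + ∑ (range (k ∸ 1)) (λ i → total (λ φ → ∑ (edgesAt H v) (λ P → ∑ (others i P) (λ Q → ind (E? S v P Q φ)))))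
        ≡⟨ cong (N (v ∷ S) +_) (∑-cong (range (k ∸ 1)) (λ i → trans
             (∑-swap (vectors n) (edgesAt H v) _)
             (∑-cong (edgesAt H v) (λ P → ∑-swap (vectors n) (others i P) _)))) ⟩
      N (v ∷ S) + ∑ (range (k ∸ 1)) (bad S v) ∎
      where
      open ≤-Reasoning
      conflicts : Vec (Fin R) n → ℕ
      conflicts φ = ∑ (range (k ∸ 1)) (λ i → ∑ (edgesAt H v) (λ P → ∑ (others i P) (λ Q → ind (E? S v P Q φ))))
      pointwise : ∀ φ → good S φ → 1 ≤ ind (good? (v ∷ S) φ) + conflicts φ
      pointwise φ g with good? (v ∷ S) φ
      ... | yes _ = s≤s z≤n
      ... | no ¬g with cover φ v∉S g ¬g
      ...   | P , Q , P∈ , Q∈ , P≢Q , P∩Q , v∈P , e = begin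
        1
          ≡⟨ ind-yes (E? S v P Q φ) e ⟨
        ind (E? S v P Q φ)
          ≤⟨ ∑-term (λ Q → ind (E? S v P Q φ)) (∈-filter⁺ (λ Q → ¬? (P ≟ˢ Q) ×-dec (∣ P ─ Q ∣ ≟ i)) Q∈ (P≢Q , refl)) ⟩
        ∑ (others i P) (λ Q → ind (E? S v P Q φ))
          ≤⟨ ∑-term (λ P → ∑ (others i P) (λ Q → ind (E? S v P Q φ))) (∈-filter⁺ (v ∈?_) P∈ v∈P) ⟩
        ∑ (edgesAt H v) (λ P → ∑ (others i P) (λ Q → ind (E? S v P Q φ)))
          ≤⟨ ∑-term (λ i → ∑ (edgesAt H v) (λ P → ∑ (others i P) (λ Q → ind (E? S v P Q φ))))
               (∈-range⁺ (k ∸ 1) (∣P─Q∣>0 P∈ Q∈ P≢Q) (∸-monoˡ-≤ 1 (∣P─Q∣<k P∈ P∩Q))) ⟩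
        conflicts φ ∎
        where
        i : ℕ
        i = ∣ P ─ Q ∣

    weights≤num : ∀ v i → 1 ≤ i → (k ∸ i) * ∑ (edgesAt H v) (λ P → ∑ (others i P) (weight (w₁ i) (w₂ i) v)) ≤ num i
    weights≤num v i 1≤i = begin
      (k ∸ i) * ∑ (edgesAt H v) (λ P → ∑ (others i P) (weight (w₁ i) (w₂ i) v))
        ≡⟨ ∑-* (edgesAt H v) (k ∸ i) _ ⟨
      ∑ (edgesAt H v) (λ P → (k ∸ i) * ∑ (others i P) (weight (w₁ i) (w₂ i) v))
        ≤⟨ ∑-mono (edgesAt H v) (λ P P∈ → atEdge P (∈-filter⁻ (v ∈?_) {xs = edges H} P∈)) ⟩
      ∑ (edgesAt H v) (λ _ → (k ∸ 1) * (Δ ∸ 1) * (w₁ i + w₂ i))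
        ≡⟨ ∑-const (edgesAt H v) _ ⟩
      deg H v * ((k ∸ 1) * (Δ ∸ 1) * (w₁ i + w₂ i))
        ≤⟨ *-monoˡ-≤ ((k ∸ 1) * (Δ ∸ 1) * (w₁ i + w₂ i)) (maxDeg v) ⟩
      Δ * ((k ∸ 1) * (Δ ∸ 1) * (w₁ i + w₂ i))
        ≡⟨ *-assoc Δ ((k ∸ 1) * (Δ ∸ 1)) (w₁ i + w₂ i) ⟨
      Δ * ((k ∸ 1) * (Δ ∸ 1)) * (w₁ i + w₂ i)
        ≤⟨ num≥ i ⟩
      num i ∎
      where
      open ≤-Reasoning
      distribute : ∀ c w₁ a w₂ b → c * (w₁ * a + w₂ * b) ≡ c * a * w₁ + c * b * w₂
      distribute = solve-∀
      atEdge : ∀ P → P ∈ₗ edges H × v ∈ P →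
        (k ∸ i) * ∑ (others i P) (weight (w₁ i) (w₂ i) v) ≤ (k ∸ 1) * (Δ ∸ 1) * (w₁ i + w₂ i)
      atEdge P (P∈ , v∈P) = begin
        (k ∸ i) * ∑ (others i P) (weight (w₁ i) (w₂ i) v)
          ≡⟨ cong ((k ∸ i) *_) (trans (∑-+ (others i P) _ _) (cong₂ _+_ (∑-* (others i P) (w₁ i) _) (∑-* (others i P) (w₂ i) _))) ⟩
        (k ∸ i) * (w₁ i * out + w₂ i * inn)
          ≡⟨ distribute (k ∸ i) (w₁ i) out (w₂ i) inn ⟩
        (k ∸ i) * out * w₁ i + (k ∸ i) * inn * w₂ i
          ≤⟨ +-mono-≤ (*-monoˡ-≤ (w₁ i) (others-∌ i P∈ v∈P)) (*-monoˡ-≤ (w₂ i) (others-∋ i 1≤i P∈ v∈P)) ⟩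
        (k ∸ 1) * (Δ ∸ 1) * w₁ i + (k ∸ 1) * (Δ ∸ 1) * w₂ i
          ≡⟨ *-distribˡ-+ ((k ∸ 1) * (Δ ∸ 1)) (w₁ i) (w₂ i) ⟨
        (k ∸ 1) * (Δ ∸ 1) * (w₁ i + w₂ i) ∎
        where
        out inn : ℕ
        out = ∑ (others i P) (λ Q → ind (¬? (v ∈? Q)))
        inn = ∑ (others i P) (λ Q → ind (v ∈? Q))

    bad≤ : ∀ S v → v ∉ₗ S → ControlRule S v → ∀ i → i ∈ₗ range (k ∸ 1) → M * R * bad S v i ≤ t i * N S
    bad≤ S v v∉S rule i i∈ with ∈-range⁻ (k ∸ 1) i∈
    bad≤ S v v∉S rule i@(suc j) i∈ | 1≤i , i≤ with inI? i 1≤i i≤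
    ... | yes inI = controlled⇒bound {S} {j} (k ∸ i) {{>-nonZero (m<n⇒0<n∸m (subst (i <_) (m+[n∸m]≡n k≥1) (s≤s i≤)))}} (num i) (t i)
            (Controlled-∑ (edgesAt H v) {S} {j} (λ P P∈ → Controlled-∑ (others i P) {S} {j} (λ Q Q∈ → pair P Q
              (∈-filter⁻ (v ∈?_) {xs = edges H} P∈)
              (∈-filter⁻ (λ Q → ¬? (P ≟ˢ Q) ×-dec (∣ P ─ Q ∣ ≟ i)) {xs = edges H} Q∈))))
            (weights≤num v i 1≤i) (t≥ i 1≤i i≤ inI)
      where
      k≥1 : 1 ≤ k
      k≥1 = ≤-trans (≤-trans 1≤i i≤) (m∸n≤m k 1)
      pair : ∀ P Q → P ∈ₗ edges H × v ∈ P → Q ∈ₗ edges H × (P ≢ Q × ∣ P ─ Q ∣ ≡ i) →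
        Controlled S j (total (ind ∘ E? S v P Q)) (weight (w₁ i) (w₂ i) v Q)
      pair P Q (P∈ , v∈P) (Q∈ , _ , e) = control v∉S P∈ Q∈ v∈P e rule
    -- No two edges have a difference of size `i`, so the count is zero whatever `t i` is.
    ... | no ∉I = ≤-trans (≤-reflexive (trans (cong (M * R *_) (∑-zero (edgesAt H v) λ P P∈ →
            ∑-zero (others i P) λ Q Q∈ → ⊥-elim (absurd P Q
              (∈-filter⁻ (v ∈?_) {xs = edges H} P∈)
              (∈-filter⁻ (λ Q → ¬? (P ≟ˢ Q) ×-dec (∣ P ─ Q ∣ ≟ i)) {xs = edges H} Q∈)))) (*-zeroʳ (M * R)))) z≤n
      where
      absurd : ∀ P Q → P ∈ₗ edges H × v ∈ P → Q ∈ₗ edges H × (P ≢ Q × ∣ P ─ Q ∣ ≡ i) → ⊥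
      absurd P Q (P∈ , _) (Q∈ , _ , e) = ∉I (1≤i , i≤ , P , Q , P∈ , Q∈ , e)

    colouring-exists : (∀ φ → good [] φ) → ∃ (good (allFin n))
    colouring-exists start = ∑-ind>0 (good? (allFin n)) (vectors n)
      (N-pos (λ S v v∉S rule → growth-step (range (k ∸ 1)) (bad S v) t (N-cover S v v∉S) (bad≤ S v v∉S rule) slack)
             (ℕ.>-nonZero⁻¹ B) base (Uniqueₚ.allFin⁺ n))
      where
      base : 0 < N []
      base = subst (0 <_) (trans (sym (trans (∑-const (vectors n) 1) (*-identityʳ _)))
                                 (∑-cong (vectors n) (λ φ → sym (ind-yes (good? [] φ) (start φ)))))
                   (vectors-nonempty n (ℕ.>-nonZero⁻¹ R))

-- Conflicts of colour sets and colour multisets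

Within : ∀ {n} → List (Fin n) → Subset n → Subset n → Set
Within S P Q = (∀ x → x ∈ P ─ Q → x ∈ₗ S) × (∀ x → x ∈ Q ─ P → x ∈ₗ S)

within-drop : ∀ {n v S} {P Q : Subset n} → Within (v ∷ S) P Q → v ∉ P ─ Q → v ∉ Q ─ P → Within S P Q
within-drop (f , g) v∉ v∉′ = (λ x x∈ → strip v∉ x∈ (f x x∈)) , (λ x x∈ → strip v∉′ x∈ (g x x∈))
  where
  strip : ∀ {v S x T} → v ∉ T → x ∈ T → x ∈ₗ v ∷ S → x ∈ₗ S
  strip v∉T x∈T (here refl) = ⊥-elim (v∉T x∈T)
  strip v∉T x∈T (there x∈S) = x∈S

module Conflicts {n R : ℕ} (H : Hypergraph n)
  (Conflict : List (Fin n) → Subset n → Subset n → Vec (Fin R) n → Set)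
  (conflict? : ∀ S P Q φ → Dec (Conflict S P Q φ))
  (conflict-⊆ : ∀ {S S′ P Q φ} → Within S P Q → S ⊆ S′ → Conflict S P Q φ → Conflict S′ P Q φ)
  (conflict-local : ∀ {S P Q φ ψ} → Within S P Q →
    (∀ x → x ∈ₗ S → Vec.lookup φ x ≡ Vec.lookup ψ x) → Conflict S P Q φ → Conflict S P Q ψ)
  (conflict-sym : ∀ {S P Q φ} → Conflict S P Q φ → Conflict S Q P φ)
  where

  open import Data.List.Membership.DecPropositional (Fin._≟_ {n}) using () renaming (_∈?_ to _∈ᶠ?_)

  within? : ∀ S P Q → Dec (Within S P Q)
  within? S P Q = Finₚ.all? (λ x → (x ∈? P ─ Q) →-dec (x ∈ᶠ? S)) ×-dec
                  Finₚ.all? (λ x → (x ∈? Q ─ P) →-dec (x ∈ᶠ? S))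

  Bad : List (Fin n) → Vec (Fin R) n → Subset n → Subset n → Set
  Bad S φ P Q = P ≢ Q × Intersect P Q × Within S P Q × Conflict S P Q φ

  bad? : ∀ S φ P Q → Dec (Bad S φ P Q)
  bad? S φ P Q = ¬? (P ≟ˢ Q) ×-dec Finₚ.any? (λ v → (v ∈? P) ×-dec (v ∈? Q))
                 ×-dec within? S P Q ×-dec conflict? S P Q φ

  bad-sym : ∀ {S} φ {P Q} → Bad S φ P Q → Bad S φ Q P
  bad-sym φ (P≢Q , (x , x∈P , x∈Q) , (f , g) , c) = (P≢Q ∘ sym) , (x , x∈Q , x∈P) , (g , f) , conflict-sym {φ = φ} c

  Good : List (Fin n) → Vec (Fin R) n → Set
  Good S φ = ¬ Any (λ P → Any (Bad S φ P) (edges H)) (edges H)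

  good? : ∀ S φ → Dec (Good S φ)
  good? S φ = ¬? (Any.any? (λ P → Any.any? (bad? S φ P) (edges H)) (edges H))

  good⇒¬bad : ∀ {S} φ {P Q} → Good S φ → P ∈ₗ edges H → Q ∈ₗ edges H → ¬ Bad S φ P Q
  good⇒¬bad φ g P∈ Q∈ b = g (lose P∈ (lose Q∈ b))

  ¬good⇒bad : ∀ {S} φ → ¬ Good S φ → ∃ λ P → ∃ λ Q → P ∈ₗ edges H × Q ∈ₗ edges H × Bad S φ P Q
  ¬good⇒bad {S} φ ¬g with find (Dec.decidable-stable (Any.any? (λ P → Any.any? (bad? S φ P) (edges H)) (edges H)) ¬g)
  ... | P , P∈ , a with find a
  ...   | Q , Q∈ , b = P , Q , P∈ , Q∈ , b

  good-⊆ : ∀ {S S′ φ} → S ⊆ S′ → Good S′ φ → Good S φ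
  good-⊆ S⊆ g = g ∘ Any.map (Any.map λ (P≢Q , P∩Q , (a , b) , c) →
    P≢Q , P∩Q , ((λ x x∈ → S⊆ (a x x∈)) , (λ x x∈ → S⊆ (b x x∈))) , conflict-⊆ (a , b) S⊆ c)

  good-local : ∀ {S φ ψ} → (∀ x → x ∈ₗ S → Vec.lookup φ x ≡ Vec.lookup ψ x) → Good S φ → Good S ψ
  good-local eq g = g ∘ Any.map (Any.map λ (P≢Q , P∩Q , w , c) →
    P≢Q , P∩Q , w , conflict-local w (λ x x∈ → sym (eq x x∈)) c)

  good-[] : ∀ {k} → Uniform k H → ∀ φ → Good [] φ
  good-[] uniform φ a with find a
  ... | P , P∈ , a′ with find a′
  ...   | Q , Q∈ , P≢Q , _ , (f , g) , _ = P≢Q (─-empty⇒≡ P Q (empty (P ─ Q) f) (empty (Q ─ P) g))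
    where
    empty : ∀ T → (∀ x → x ∈ T → x ∈ₗ []) → ∣ T ∣ ≡ 0
    empty T h with elems T | length-elems T | (λ x → ∈-elems⁻ {p = T} {x})
    ... | []    | e | _ = sym e
    ... | x ∷ _ | _ | m = contradiction (h x (m x (here refl))) λ ()

module Colourings {n k Δ R : ℕ} .{{_ : NonZero R}} (H : Hypergraph n)
  (uniform : Uniform k H) (maxDeg : MaxDegree≤ H Δ)
  (col : Fin n → Fin R → ℕ) (col-inj : ∀ v {c d} → col v c ≡ col v d → c ≡ d)
  (M B : ℕ) .{{_ : NonZero B}}
  where

  open Colouring col col-inj
  open import Data.List.Membership.DecPropositional (Fin._≟_ {n}) using () renaming (_∈?_ to _∈ᶠ?_)

  colour-cong : ∀ {φ ψ : Vec (Fin R) n} x → Vec.lookup φ x ≡ Vec.lookup ψ x → colour φ x ≡ colour ψ x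
  colour-cong x = cong (col x)

  ∣P∩Q∣≡k∸ : ∀ {P Q i} → P ∈ₗ edges H → ∣ P ─ Q ∣ ≡ i → ∣ P ∩ Q ∣ ≡ k ∸ i
  ∣P∩Q∣≡k∸ {P} {Q} P∈ refl =
    sym (trans (cong (_∸ ∣ P ─ Q ∣) (sym (trans (∣p─q∣+∣p∩q∣≡∣p∣ P Q) (uniform P P∈)))) (m+n∸m≡n ∣ P ─ Q ∣ _))

  -- Conflicts of colour multisets

  module Multisets where

    colours : Vec (Fin R) n → Subset n → List ℕ
    colours φ T = map (colour φ) (elems T)

    colours-cong : ∀ {φ ψ} T → (∀ x → x ∈ T → Vec.lookup φ x ≡ Vec.lookup ψ x) → colours φ T ≡ colours ψ T
    colours-cong {φ} {ψ} T eq = map-cong-local (All.tabulate λ {x} x∈ → colour-cong {φ} {ψ} x (eq x (∈-elems⁻ x∈)))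

    -- Common vertices contribute equally to both multisets, so comparing the two differences
    -- suffices; these lie in `S` whenever the definition is applied under `Within`.
    Conflict : List (Fin n) → Subset n → Subset n → Vec (Fin R) n → Set
    Conflict S P Q φ = SameBag (colours φ (Q ─ P)) (colours φ (P ─ Q))

    conflict-local : ∀ {S P Q φ ψ} → Within S P Q → (∀ x → x ∈ₗ S → Vec.lookup φ x ≡ Vec.lookup ψ x) →
      Conflict S P Q φ → Conflict S P Q ψ
    conflict-local {S} {P} {Q} {φ} {ψ} (f , g) eq = subst₂ SameBag
      (colours-cong {φ} {ψ} (Q ─ P) (λ x x∈ → eq x (g x x∈))) (colours-cong {φ} {ψ} (P ─ Q) (λ x x∈ → eq x (f x x∈)))

    open Conflicts H Conflict (λ S P Q φ → sameBag? (colours φ (Q ─ P)) (colours φ (P ─ Q)))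
      (λ _ _ → id) (λ {S} {P} {Q} {φ} {ψ} → conflict-local {S} {P} {Q} {φ} {ψ}) (λ h c → sym (h c)) public

    open Uncolouring {k = k} {Δ} H uniform maxDeg Good good?
      (λ {S} {S′} {φ} → good-⊆ {S} {S′} {φ}) (λ {S} {φ} {ψ} → good-local {S} {φ} {ψ}) M B

    E : List (Fin n) → Fin n → Subset n → Subset n → Vec (Fin R) n → Set
    E S v P Q φ = Good S φ × Bad (v ∷ S) φ P Q × v ∉ Q

    e? : ∀ S v P Q φ → Dec (E S v P Q φ)
    e? S v P Q φ = good? S φ ×-dec bad? (v ∷ S) φ P Q ×-dec ¬? (v ∈? Q)

    NewConflict : List (Fin n) → Fin n → Vec (Fin R) n → Set
    NewConflict S v φ = ∃ λ P → ∃ λ Q →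
      P ∈ₗ edges H × Q ∈ₗ edges H × P ≢ Q × Intersect P Q × v ∈ P × E S v P Q φ

    -- A vertex in both edges or in neither does not affect the differences, so such a conflict
    -- would exist before `v` is added. Otherwise exchanging the edges puts `v` into P ─ Q.
    cover : ∀ {S v} φ → v ∉ₗ S → Good S φ → ¬ Good (v ∷ S) φ → NewConflict S v φ
    cover {S} {v} φ v∉S g ¬g = cases (v ∈? P) (v ∈? Q)
      where
      found : ∃ λ P → ∃ λ Q → P ∈ₗ edges H × Q ∈ₗ edges H × Bad (v ∷ S) φ P Q
      found = ¬good⇒bad φ ¬g
      P Q : Subset n
      P = proj₁ found
      Q = proj₁ (proj₂ found)
      P∈ : P ∈ₗ edges H
      P∈ = proj₁ (proj₂ (proj₂ found))
      Q∈ : Q ∈ₗ edges H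
      Q∈ = proj₁ (proj₂ (proj₂ (proj₂ found)))
      b : Bad (v ∷ S) φ P Q
      b = proj₂ (proj₂ (proj₂ (proj₂ found)))
      b′ : Bad (v ∷ S) φ Q P
      b′ = bad-sym φ b
      older : v ∉ P ─ Q → v ∉ Q ─ P → ⊥
      older v∉ v∉′ = let (P≢Q , P∩Q , w , c) = b in
        good⇒¬bad φ g P∈ Q∈ (P≢Q , P∩Q , within-drop w v∉ v∉′ , c)
      cases : Dec (v ∈ P) → Dec (v ∈ Q) → NewConflict S v φ
      cases (yes v∈P) (no v∉Q)  = P , Q , P∈ , Q∈ , proj₁ b , proj₁ (proj₂ b) , v∈P , g , b , v∉Q
      cases (no v∉P)  (yes v∈Q) = Q , P , Q∈ , P∈ , proj₁ b′ , proj₁ (proj₂ b′) , v∈Q , g , b′ , v∉P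
      cases (yes v∈P) (yes v∈Q) = ⊥-elim (older (λ v∈ → x∈p─q⇒x∉q P Q v∈ v∈Q) (λ v∈ → x∈p─q⇒x∉q Q P v∈ v∈P))
      cases (no v∉P)  (no v∉Q)  = ⊥-elim (older (λ v∈ → v∉P (p─q⊆p P Q v∈)) (λ v∈ → v∉Q (p─q⊆p Q P v∈)))

    -- Recolouring P ─ Q leaves the colours on Q ─ P alone, and the new colours must form exactly
    -- that bag. The event excludes v ∈ Q, hence the weight 0.
    control : ∀ {S v P Q j} → v ∉ₗ S → P ∈ₗ edges H → Q ∈ₗ edges H → v ∈ P → ∣ P ─ Q ∣ ≡ suc j →
      ControlRule S v → Controlled S j (total (ind ∘ e? S v P Q)) (weight (suc j !) 0 v Q)
    control {S} {v} {P} {Q} {j} v∉S P∈ Q∈ v∈P size rule = cases (v ∈? Q) (within? (v ∷ S) P Q)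
      where
      us : List (Fin n)
      us = elems (P ─ Q)
      len : length us ≡ suc j
      len = trans (length-elems (P ─ Q)) size
      bound : ∀ φ → ∑ᶜˢ us (ind ∘ e? S v P Q) φ ≤ suc j !
      bound φ = ≤-trans (∑ᶜˢ≤∑ˢ (e? S v P Q) (sameBag? (colours φ (Q ─ P))) (elems-unique (P ─ Q)) φ
          (λ ψ agr (_ , (_ , _ , _ , c) , _) → subst (λ W → SameBag W (map (colour ψ) us))
            (sym (colours-cong {φ} {ψ} (Q ─ P) (λ x x∈ → agr x λ x∈us → x∈p─q⇒x∉q P Q (∈-elems⁻ x∈us) (p─q⊆p Q P x∈)))) c))
        (≤-trans (sameBag-count us (colours φ (Q ─ P)) sizes) (≤-reflexive (cong _! len)))
        where
        sizes : length (colours φ (Q ─ P)) ≡ length us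
        sizes = begin
          length (colours φ (Q ─ P))     ≡⟨ length-map (colour φ) (elems (Q ─ P)) ⟩
          length (elems (Q ─ P))         ≡⟨ length-elems (Q ─ P) ⟩
          ∣ Q ─ P ∣                      ≡⟨ ∣p─q∣≡∣q─p∣ Q P (trans (uniform Q Q∈) (sym (uniform P P∈))) ⟩
          ∣ P ─ Q ∣                      ≡⟨ length-elems (P ─ Q) ⟨
          length us ∎ where open ≡-Reasoning
      cases : Dec (v ∈ Q) → Dec (Within (v ∷ S) P Q) →
        Controlled S j (total (ind ∘ e? S v P Q)) (weight (suc j !) 0 v Q)
      cases (yes v∈Q) _ = Controlled-zero {S} {j} (weight (suc j !) 0 v Q) (∑-zero (vectors n) λ φ _ →
        ind-no (e? S v P Q φ) λ (_ , _ , v∉Q) → v∉Q v∈Q)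
      cases _ (no ¬w) = Controlled-zero {S} {j} (weight (suc j !) 0 v Q) (∑-zero (vectors n) λ φ _ →
        ind-no (e? S v P Q φ) λ (_ , (_ , _ , w , _) , _) → ¬w w)
      cases (no v∉Q) (yes (f , _)) = Controlled-mono {S} {j} ≤-refl (weight-∌ (suc j !) 0 v∉Q)
        (rule (e? S v P Q) j (suc j !) len (elems-unique (P ─ Q)) (∈-elems⁺ (x∈p∧x∉q⇒x∈p─q v∈P v∉Q))
          (λ x∈ → f _ (∈-elems⁻ x∈)) (λ _ → proj₁) bound)

    exists : (num t : ℕ → ℕ) →
      (∀ i → Δ * ((k ∸ 1) * (Δ ∸ 1)) * (i ! + 0) ≤ num i) →
      (∀ i → 1 ≤ i → i ≤ k ∸ 1 → InI k H i → num i * M ^ i ≤ t i * B ^ (i ∸ 1) * (k ∸ i)) →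
      B + ∑ (range (k ∸ 1)) t ≤ M * R → ∃ (Good (allFin n))
    exists num t num≥ t≥ slack = colouring-exists E e? cover _! (λ _ → 0) control num t num≥ t≥ slack (good-[] uniform)

  -- Conflicts of colour sets

  module Sets where

    -- The inclusion φ(P ∩ S) ⊆ φ(Q ∩ S). Common vertices cannot be discarded as for multisets,
    -- since their colours may match vertices of the differences.
    Half : List (Fin n) → Subset n → Subset n → Vec (Fin R) n → Set
    Half S P Q φ = ∀ u → u ∈ P → u ∈ₗ S → ∃ λ w → w ∈ Q × w ∈ₗ S × colour φ u ≡ colour φ w

    half? : ∀ S P Q φ → Dec (Half S P Q φ)
    half? S P Q φ = Finₚ.all? λ u → (u ∈? P) →-dec (u ∈ᶠ? S) →-dec
      Finₚ.any? λ w → (w ∈? Q) ×-dec (w ∈ᶠ? S) ×-dec (colour φ u ≟ colour φ w)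

    Conflict : List (Fin n) → Subset n → Subset n → Vec (Fin R) n → Set
    Conflict S P Q φ = Half S P Q φ × Half S Q P φ

    -- A vertex of `P` that is new in `S′` is outside P ─ Q, hence also in `Q`, and matches itself.
    half-⊆ : ∀ {S S′ P Q φ} → (∀ x → x ∈ P ─ Q → x ∈ₗ S) → S ⊆ S′ → Half S P Q φ → Half S′ P Q φ
    half-⊆ {S} {P = P} {Q} f S⊆ h u u∈P u∈S′ with u ∈ᶠ? S
    ... | yes u∈S with h u u∈P u∈S
    ...   | w , w∈Q , w∈S , e = w , w∈Q , S⊆ w∈S , e
    half-⊆ {S} {P = P} {Q} f S⊆ h u u∈P u∈S′ | no u∉S with u ∈? Q
    ... | yes u∈Q = u , u∈Q , u∈S′ , refl
    ... | no u∉Q  = ⊥-elim (u∉S (f u (x∈p∧x∉q⇒x∈p─q u∈P u∉Q)))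

    half-local : ∀ {S P Q φ ψ} → (∀ x → x ∈ₗ S → Vec.lookup φ x ≡ Vec.lookup ψ x) → Half S P Q φ → Half S P Q ψ
    half-local {φ = φ} {ψ} eq h u u∈P u∈S with h u u∈P u∈S
    ... | w , w∈Q , w∈S , e = w , w∈Q , w∈S ,
      trans (sym (colour-cong {φ} {ψ} u (eq u u∈S))) (trans e (colour-cong {φ} {ψ} w (eq w w∈S)))

    conflict-⊆ : ∀ {S S′ P Q φ} → Within S P Q → S ⊆ S′ → Conflict S P Q φ → Conflict S′ P Q φ
    conflict-⊆ {φ = φ} (f , g) S⊆ (h , h′) = half-⊆ {φ = φ} f S⊆ h , half-⊆ {φ = φ} g S⊆ h′

    conflict-local : ∀ {S P Q φ ψ} → Within S P Q → (∀ x → x ∈ₗ S → Vec.lookup φ x ≡ Vec.lookup ψ x) →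
      Conflict S P Q φ → Conflict S P Q ψ
    conflict-local {φ = φ} {ψ} _ eq (h , h′) = half-local {φ = φ} {ψ} eq h , half-local {φ = φ} {ψ} eq h′

    open Conflicts H Conflict (λ S P Q φ → half? S P Q φ ×-dec half? S Q P φ)
      (λ {S} {S′} {P} {Q} {φ} → conflict-⊆ {S} {S′} {P} {Q} {φ})
      (λ {S} {P} {Q} {φ} {ψ} → conflict-local {S} {P} {Q} {φ} {ψ}) swap public

    open Uncolouring {k = k} {Δ} H uniform maxDeg Good good?
      (λ {S} {S′} {φ} → good-⊆ {S} {S′} {φ}) (λ {S} {φ} {ψ} → good-local {S} {φ} {ψ}) M B

    Twin : Fin n → Subset n → Subset n → Vec (Fin R) n → Set
    Twin v P Q φ = ∃ λ u → u ∈ P ─ Q × colour φ u ≡ colour φ v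

    twin? : ∀ v P Q φ → Dec (Twin v P Q φ)
    twin? v P Q φ = Finₚ.any? λ u → (u ∈? P ─ Q) ×-dec (colour φ u ≟ colour φ v)

    -- If `u` was matched by `v`, then either `u` lies in `Q` and can match itself, or it is a twin
    -- of `v`.
    half-drop : ∀ {S v P Q φ} → (v ∈ Q → ¬ Twin v P Q φ) → Half (v ∷ S) P Q φ → Half S P Q φ
    half-drop {Q = Q} ¬t h u u∈P u∈S with h u u∈P (there u∈S)
    ... | w , w∈Q , there w∈S , e = w , w∈Q , w∈S , e
    ... | w , w∈Q , here refl , e with u ∈? Q
    ...   | yes u∈Q = u , u∈Q , u∈S , refl
    ...   | no u∉Q  = ⊥-elim (¬t w∈Q (u , x∈p∧x∉q⇒x∈p─q u∈P u∉Q , e))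

    E : List (Fin n) → Fin n → Subset n → Subset n → Vec (Fin R) n → Set
    E S v P Q φ = Good S φ × Bad (v ∷ S) φ P Q × (v ∈ Q → Twin v P Q φ)

    e? : ∀ S v P Q φ → Dec (E S v P Q φ)
    e? S v P Q φ = good? S φ ×-dec bad? (v ∷ S) φ P Q ×-dec ((v ∈? Q) →-dec twin? v P Q φ)

    NewConflict : List (Fin n) → Fin n → Vec (Fin R) n → Set
    NewConflict S v φ = ∃ λ P → ∃ λ Q →
      P ∈ₗ edges H × Q ∈ₗ edges H × P ≢ Q × Intersect P Q × v ∈ P × E S v P Q φ

    -- A vertex v ∈ P ∩ Q only creates a conflict if its colour already occurs on
    -- exactly one of P and Q, hence on P ─ Q up to exchanging P and Q.
    cover : ∀ {S v} φ → v ∉ₗ S → Good S φ → ¬ Good (v ∷ S) φ → NewConflict S v φ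
    cover {S} {v} φ v∉S g ¬g = cases (v ∈? P) (v ∈? Q)
      where
      found : ∃ λ P → ∃ λ Q → P ∈ₗ edges H × Q ∈ₗ edges H × Bad (v ∷ S) φ P Q
      found = ¬good⇒bad φ ¬g
      P Q : Subset n
      P = proj₁ found
      Q = proj₁ (proj₂ found)
      P∈ : P ∈ₗ edges H
      P∈ = proj₁ (proj₂ (proj₂ found))
      Q∈ : Q ∈ₗ edges H
      Q∈ = proj₁ (proj₂ (proj₂ (proj₂ found)))
      b : Bad (v ∷ S) φ P Q
      b = proj₂ (proj₂ (proj₂ (proj₂ found)))
      b′ : Bad (v ∷ S) φ Q P
      b′ = bad-sym φ b
      older : v ∉ P ─ Q → v ∉ Q ─ P → (v ∈ Q → ¬ Twin v P Q φ) → (v ∈ P → ¬ Twin v Q P φ) → ⊥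
      older v∉ v∉′ ¬t ¬t′ = let (P≢Q , P∩Q , w , h , h′) = b in
        good⇒¬bad φ g P∈ Q∈ (P≢Q , P∩Q , within-drop w v∉ v∉′ , half-drop {φ = φ} ¬t h , half-drop {φ = φ} ¬t′ h′)
      twins : v ∈ P → v ∈ Q → Dec (Twin v P Q φ) → Dec (Twin v Q P φ) → NewConflict S v φ
      twins v∈P v∈Q (yes t) _       = P , Q , P∈ , Q∈ , proj₁ b , proj₁ (proj₂ b) , v∈P , g , b , λ _ → t
      twins v∈P v∈Q (no _)  (yes t) = Q , P , Q∈ , P∈ , proj₁ b′ , proj₁ (proj₂ b′) , v∈Q , g , b′ , λ _ → t
      twins v∈P v∈Q (no ¬t) (no ¬t′) = ⊥-elim (older (λ v∈ → x∈p─q⇒x∉q P Q v∈ v∈Q) (λ v∈ → x∈p─q⇒x∉q Q P v∈ v∈P)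
        (λ _ → ¬t) (λ _ → ¬t′))
      cases : Dec (v ∈ P) → Dec (v ∈ Q) → NewConflict S v φ
      cases (yes v∈P) (no v∉Q)  = P , Q , P∈ , Q∈ , proj₁ b , proj₁ (proj₂ b) , v∈P , g , b , ⊥-elim ∘ v∉Q
      cases (no v∉P)  (yes v∈Q) = Q , P , Q∈ , P∈ , proj₁ b′ , proj₁ (proj₂ b′) , v∈Q , g , b′ , ⊥-elim ∘ v∉P
      cases (no v∉P)  (no v∉Q)  = ⊥-elim (older (λ v∈ → v∉P (p─q⊆p P Q v∈)) (λ v∈ → v∉Q (p─q⊆p Q P v∈))
        (⊥-elim ∘ v∉Q) (⊥-elim ∘ v∉P))
      cases (yes v∈P) (yes v∈Q) = twins v∈P v∈Q (twin? v P Q φ) (twin? v Q P φ)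

    -- Half of the factor `2 ^ (k ∸ i + 1) * fubini i` in `numA`, since it serves both for v ∈ Q and
    -- for v ∉ Q.
    w : ℕ → ℕ
    w i = 2 ^ (k ∸ i) * fubini i

    module _ {S v P Q j} (v∉S : v ∉ₗ S) (P∈ : P ∈ₗ edges H) (Q∈ : Q ∈ₗ edges H) (v∈P : v ∈ P)
      (size : ∣ P ─ Q ∣ ≡ suc j) (rule : ControlRule S v) (f : ∀ x → x ∈ P ─ Q → x ∈ₗ v ∷ S) where

      -- Recolouring P ─ Q does not change the colours on `Q`. The new colours must lie among those
      -- of the coloured part of `Q` and supply all of them that P ∩ Q does not; this is an instance
      -- of `Completes`.
      control-∌ : v ∉ Q → Controlled S j (total (ind ∘ e? S v P Q)) (w (suc j))
      control-∌ v∉Q = rule (e? S v P Q) j (w (suc j)) len (elems-unique (P ─ Q))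
        (∈-elems⁺ (x∈p∧x∉q⇒x∈p─q v∈P v∉Q)) (λ x∈ → f _ (∈-elems⁻ x∈)) (λ _ → proj₁) bound
        where
        us : List (Fin n)
        us = elems (P ─ Q)
        len : length us ≡ suc j
        len = trans (length-elems (P ─ Q)) size
        bound : ∀ φ → ∑ᶜˢ us (ind ∘ e? S v P Q) φ ≤ w (suc j)
        bound φ = ≤-trans (∑ᶜˢ≤∑ˢ (e? S v P Q) (completes? optional required) (elems-unique (P ─ Q)) φ completing)
          (≤-trans (completion-count optional us required) (≤-reflexive (cong₂ (λ a b → 2 ^ a * fubini b) lenY len)))
          where
          optional required : List ℕ
          -- All of P ∩ Q is taken, coloured or not, so that the number of optional colours is
          -- exactly k - i.
          optional = map (colour φ) (elems (P ∩ Q))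
          required = map (colour φ) (filter (_∈ᶠ? (v ∷ S)) (elems Q))
          lenY : length optional ≡ k ∸ suc j
          lenY = trans (length-map (colour φ) (elems (P ∩ Q))) (trans (length-elems (P ∩ Q)) (∣P∩Q∣≡k∸ P∈ size))
          completing : ∀ ψ → AgreeOff us φ ψ → E S v P Q ψ → Completes optional required (map (colour ψ) us)
          completing ψ agr (_ , (_ , _ , _ , (h , h′)) , _) = sub , sup
            where
            unchanged : ∀ {x} → x ∈ Q → colour φ x ≡ colour ψ x
            unchanged {x} x∈Q = colour-cong {φ} {ψ} x (agr x λ x∈us → x∈p─q⇒x∉q P Q (∈-elems⁻ x∈us) x∈Q)
            sub : map (colour ψ) us ⊆ required ++ optional
            sub c∈ =
              let u , u∈us , e₀ = ∈-map⁻ (colour ψ) c∈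
                  x , x∈Q , x∈S , e = h u (p─q⊆p P Q (∈-elems⁻ u∈us)) (f u (∈-elems⁻ u∈us))
              in ∈-++⁺ˡ (subst (_∈ₗ required) (trans (unchanged x∈Q) (trans (sym e) (sym e₀)))
                   (∈-map⁺ (colour φ) (∈-filter⁺ (_∈ᶠ? (v ∷ S)) (∈-elems⁺ x∈Q) x∈S)))
            attained : ∀ {c u} → u ∈ P → c ≡ colour ψ u → Dec (u ∈ Q) → c ∈ₗ map (colour ψ) us ++ optional
            attained u∈P e (yes u∈Q) = ∈-++⁺ʳ (map (colour ψ) us) (subst (_∈ₗ optional)
              (trans (unchanged u∈Q) (sym e)) (∈-map⁺ (colour φ) (∈-elems⁺ (x∈p∩q⁺ (u∈P , u∈Q)))))
            attained u∈P e (no u∉Q) = ∈-++⁺ˡ (subst (_∈ₗ map (colour ψ) us) (sym e)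
              (∈-map⁺ (colour ψ) (∈-elems⁺ (x∈p∧x∉q⇒x∈p─q u∈P u∉Q))))
            sup : required ⊆ map (colour ψ) us ++ optional
            sup c∈ =
              let x , x∈ , e₀ = ∈-map⁻ (colour φ) c∈
                  x∈′ , x∈S = ∈-filter⁻ (_∈ᶠ? (v ∷ S)) {xs = elems Q} x∈
                  x∈Q = ∈-elems⁻ x∈′
                  u , u∈P , _ , e = h′ x x∈Q x∈S
              in attained u∈P (trans e₀ (trans (unchanged x∈Q) e)) (u ∈? Q)

      -- With the twin `u` fixed, the colour of `v` is forced. Only the `j` vertices of P ─ Q other
      -- than `u` are free, whence `fubini j` in place of `fubini (suc j)`.
      control-twin : v ∈ Q → ∀ {u} → u ∈ P ─ Q →
        Controlled S j (total (λ φ → ind (e? S v P Q φ ×-dec (colour φ u ≟ colour φ v)))) (2 ^ (k ∸ suc j) * fubini j)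
      control-twin v∈Q {u} u∈ = rule (λ φ → e? S v P Q φ ×-dec (colour φ u ≟ colour φ v)) j _ (cong suc len) uq (here refl)
        (λ { (here refl) → here refl ; (there x∈) → f _ (proj₁ (rest x∈)) }) (λ _ (e , _) → proj₁ e) bound
        where
        us : List (Fin n)
        us = remove Fin._≟_ u (elems (P ─ Q))
        rest : ∀ {x} → x ∈ₗ us → x ∈ P ─ Q × u ≢ x
        rest x∈ with ∈-filter⁻ (¬? ∘ (u Fin.≟_)) {xs = elems (P ─ Q)} x∈
        ... | a , b = ∈-elems⁻ a , b
        uq : Unique (v ∷ us)
        uq = All.tabulate (λ x∈ → λ { refl → x∈p─q⇒x∉q P Q (proj₁ (rest x∈)) v∈Q })
             ∷ Uniqueₚ.filter⁺ (¬? ∘ (u Fin.≟_)) (elems-unique (P ─ Q))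
        len : length us ≡ j
        len = suc-injective (trans (length-remove Fin._≟_ (elems-unique (P ─ Q)) (∈-elems⁺ u∈))
                (trans (length-elems (P ─ Q)) size))
        u∉ : u ∉ₗ v ∷ us
        u∉ (here refl) = x∈p─q⇒x∉q P Q u∈ v∈Q
        u∉ (there u∈us) = proj₂ (rest u∈us) refl
        bound : ∀ φ → ∑ᶜˢ (v ∷ us) (λ φ → ind (e? S v P Q φ ×-dec (colour φ u ≟ colour φ v))) φ ≤ 2 ^ (k ∸ suc j) * fubini j
        bound φ = ≤-trans (∑ᶜˢ≤∑ˢ {D = D} (λ φ → e? S v P Q φ ×-dec (colour φ u ≟ colour φ v)) D? uq φ completing)
          (≤-trans (∑-colours v (c₀ ∷ []) (2 ^ (k ∸ suc j) * fubini j) forced (λ c c∉ → ∑ˢ-zero us λ l →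
                     ind-no (D? (col v c ∷ l)) λ (e , _) → c∉ (here e)))
                   (≤-reflexive (+-identityʳ _)))
          where
          c₀ : ℕ
          c₀ = colour φ u
          optional required : List ℕ
          -- The forced colour `c₀` takes the place of the old colour of `v`, which keeps the length
          -- k - i and also accounts for `u`. It is required as well, because v ∈ Q.
          optional = c₀ ∷ map (colour φ) (remove Fin._≟_ v (elems (P ∩ Q)))
          required = c₀ ∷ map (colour φ) (filter (_∈ᶠ? S) (elems Q))
          D : List ℕ → Set
          D []      = ⊥
          D (c ∷ l) = c ≡ c₀ × Completes optional required l
          D? : ∀ l → Dec (D l)
          D? []      = no id
          D? (c ∷ l) = (c ≟ c₀) ×-dec completes? optional required l
          lenY : length optional ≡ k ∸ suc j
          lenY = trans (cong suc (length-map (colour φ) (remove Fin._≟_ v (elems (P ∩ Q)))))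
            (trans (length-remove Fin._≟_ (elems-unique (P ∩ Q)) (∈-elems⁺ (x∈p∩q⁺ (v∈P , v∈Q))))
              (trans (length-elems (P ∩ Q)) (∣P∩Q∣≡k∸ P∈ size)))
          forced : ∀ c → col v c ∈ₗ c₀ ∷ [] → ∑ˢ us (λ l → ind (D? (col v c ∷ l))) ≤ 2 ^ (k ∸ suc j) * fubini j
          forced c _ = ≤-trans (∑ˢ-mono us λ l → ind-mono (D? (col v c ∷ l)) (completes? optional required l) proj₂)
            (≤-trans (completion-count optional us required) (≤-reflexive (cong₂ (λ a b → 2 ^ a * fubini b) lenY len)))
          completing : ∀ ψ → AgreeOff (v ∷ us) φ ψ → E S v P Q ψ × colour ψ u ≡ colour ψ v → D (map (colour ψ) (v ∷ us))
          completing ψ agr ((_ , (_ , _ , _ , (h , h′)) , _) , u~v) = ψv , sub , sup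
            where
            ψu : colour ψ u ≡ c₀
            ψu = sym (colour-cong {φ} {ψ} u (agr u u∉))
            ψv : colour ψ v ≡ c₀
            ψv = trans (sym u~v) ψu
            unchanged : ∀ {x} → x ∈ Q → v ≢ x → colour φ x ≡ colour ψ x
            unchanged {x} x∈Q v≢x = colour-cong {φ} {ψ} x (agr x λ
              { (here e) → v≢x (sym e) ; (there x∈us) → x∈p─q⇒x∉q P Q (proj₁ (rest x∈us)) x∈Q })
            recoloured : ∀ {c y} → y ∈ Q → y ∈ₗ v ∷ S → c ≡ colour ψ y → c ∈ₗ required
            recoloured y∈Q (here refl) e = here (trans e ψv)
            recoloured y∈Q (there y∈S) e = there (subst (_∈ₗ map (colour φ) (filter (_∈ᶠ? S) (elems Q)))
              (trans (unchanged y∈Q λ { refl → v∉S y∈S }) (sym e))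
              (∈-map⁺ (colour φ) (∈-filter⁺ (_∈ᶠ? S) (∈-elems⁺ y∈Q) y∈S)))
            sub : map (colour ψ) us ⊆ required ++ optional
            sub c∈ =
              let x , x∈us , e₀ = ∈-map⁻ (colour ψ) c∈
                  y , y∈Q , y∈S , e = h x (p─q⊆p P Q (proj₁ (rest x∈us))) (f x (proj₁ (rest x∈us)))
              in ∈-++⁺ˡ (recoloured y∈Q y∈S (trans e₀ e))
            attained : ∀ {c x} → x ∈ P → c ≡ colour ψ x → Dec (v ≡ x) → Dec (u ≡ x) → Dec (x ∈ Q) →
              c ∈ₗ map (colour ψ) us ++ optional
            attained x∈P e (yes refl) _ _ = ∈-++⁺ʳ (map (colour ψ) us) (here (trans e ψv))
            attained x∈P e (no _) (yes refl) _ = ∈-++⁺ʳ (map (colour ψ) us) (here (trans e ψu))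
            attained x∈P e (no v≢x) (no _) (yes x∈Q) = ∈-++⁺ʳ (map (colour ψ) us)
              (there (subst (_∈ₗ map (colour φ) (remove Fin._≟_ v (elems (P ∩ Q))))
                (trans (unchanged x∈Q v≢x) (sym e))
                (∈-map⁺ (colour φ) (∈-filter⁺ (¬? ∘ (v Fin.≟_)) (∈-elems⁺ (x∈p∩q⁺ (x∈P , x∈Q))) v≢x))))
            attained x∈P e (no _) (no u≢x) (no x∉Q) = ∈-++⁺ˡ (subst (_∈ₗ map (colour ψ) us) (sym e)
              (∈-map⁺ (colour ψ) (∈-filter⁺ (¬? ∘ (u Fin.≟_)) (∈-elems⁺ (x∈p∧x∉q⇒x∈p─q x∈P x∉Q)) u≢x)))
            sup : required ⊆ map (colour ψ) us ++ optional
            sup (here refl) = ∈-++⁺ʳ (map (colour ψ) us) (here refl)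
            sup (there c∈) =
              let y , y∈ , e₀ = ∈-map⁻ (colour φ) c∈
                  y∈′ , y∈S = ∈-filter⁻ (_∈ᶠ? S) {xs = elems Q} y∈
                  y∈Q = ∈-elems⁻ y∈′
                  x , x∈P , _ , e = h′ y y∈Q (there y∈S)
              in attained x∈P (trans e₀ (trans (unchanged y∈Q λ { refl → v∉S y∈S }) e)) (v Fin.≟ x) (u Fin.≟ x) (x ∈? Q)

      -- A union bound over the `suc j` possible twins; `fubini-growth` absorbs their number.
      control-∋ : v ∈ Q → Controlled S j (total (ind ∘ e? S v P Q)) (w (suc j))
      control-∋ v∈Q = Controlled-mono {S} {j} split weights
        (Controlled-∑ (elems (P ─ Q)) {S} {j} (λ u u∈ → control-twin v∈Q (∈-elems⁻ u∈)))
        where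
        open ≤-Reasoning
        split : total (ind ∘ e? S v P Q) ≤
          ∑ (elems (P ─ Q)) (λ u → total (λ φ → ind (e? S v P Q φ ×-dec (colour φ u ≟ colour φ v))))
        split = begin
          total (ind ∘ e? S v P Q)
            ≤⟨ ∑-mono (vectors n) (λ φ _ → ind-≤ (e? S v P Q φ) (λ e → pointwise φ e (proj₂ (proj₂ e) v∈Q))) ⟩
          total (λ φ → ∑ (elems (P ─ Q)) (λ u → ind (e? S v P Q φ ×-dec (colour φ u ≟ colour φ v))))
            ≡⟨ ∑-swap (vectors n) (elems (P ─ Q)) _ ⟩
          ∑ (elems (P ─ Q)) (λ u → total (λ φ → ind (e? S v P Q φ ×-dec (colour φ u ≟ colour φ v)))) ∎
          where
          pointwise : ∀ φ → E S v P Q φ → Twin v P Q φ →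
            1 ≤ ∑ (elems (P ─ Q)) (λ u → ind (e? S v P Q φ ×-dec (colour φ u ≟ colour φ v)))
          pointwise φ e (u , u∈ , u~v) = ≤-trans
            (≤-reflexive (sym (ind-yes (e? S v P Q φ ×-dec (colour φ u ≟ colour φ v)) (e , u~v))))
            (∑-term (λ u → ind (e? S v P Q φ ×-dec (colour φ u ≟ colour φ v))) (∈-elems⁺ u∈))
        weights : ∑ (elems (P ─ Q)) (λ _ → 2 ^ (k ∸ suc j) * fubini j) ≤ w (suc j)
        weights = begin
          ∑ (elems (P ─ Q)) (λ _ → 2 ^ (k ∸ suc j) * fubini j)     ≡⟨ ∑-const (elems (P ─ Q)) _ ⟩
          length (elems (P ─ Q)) * (2 ^ (k ∸ suc j) * fubini j)    ≡⟨ cong (_* (2 ^ (k ∸ suc j) * fubini j)) (trans (length-elems (P ─ Q)) size) ⟩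
          suc j * (2 ^ (k ∸ suc j) * fubini j)                     ≡⟨ *-leftComm (suc j) (2 ^ (k ∸ suc j)) (fubini j) ⟩
          2 ^ (k ∸ suc j) * (suc j * fubini j)                     ≤⟨ *-monoʳ-≤ (2 ^ (k ∸ suc j)) (fubini-growth j) ⟩
          w (suc j) ∎

    control : ∀ {S v P Q j} → v ∉ₗ S → P ∈ₗ edges H → Q ∈ₗ edges H → v ∈ P → ∣ P ─ Q ∣ ≡ suc j →
      ControlRule S v → Controlled S j (total (ind ∘ e? S v P Q)) (weight (w (suc j)) (w (suc j)) v Q)
    control {S} {v} {P} {Q} {j} v∉S P∈ Q∈ v∈P size rule = cases (v ∈? Q) (within? (v ∷ S) P Q)
      where
      cases : Dec (v ∈ Q) → Dec (Within (v ∷ S) P Q) →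
        Controlled S j (total (ind ∘ e? S v P Q)) (weight (w (suc j)) (w (suc j)) v Q)
      cases _ (no ¬w) = Controlled-zero {S} {j} (weight (w (suc j)) (w (suc j)) v Q) (∑-zero (vectors n) λ φ _ →
        ind-no (e? S v P Q φ) λ (_ , (_ , _ , w , _) , _) → ¬w w)
      cases (yes v∈Q) (yes (f , _)) = Controlled-mono {S} {j} ≤-refl (weight-∋ (w (suc j)) (w (suc j)) v∈Q)
        (control-∋ v∉S P∈ Q∈ v∈P size rule f v∈Q)
      cases (no v∉Q) (yes (f , _)) = Controlled-mono {S} {j} ≤-refl (weight-∌ (w (suc j)) (w (suc j)) v∉Q)
        (control-∌ v∉S P∈ Q∈ v∈P size rule f v∉Q)

    exists : (num t : ℕ → ℕ) →
      (∀ i → Δ * ((k ∸ 1) * (Δ ∸ 1)) * (w i + w i) ≤ num i) →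
      (∀ i → 1 ≤ i → i ≤ k ∸ 1 → InI k H i → num i * M ^ i ≤ t i * B ^ (i ∸ 1) * (k ∸ i)) →
      B + ∑ (range (k ∸ 1)) t ≤ M * R → ∃ (Good (allFin n))
    exists num t num≥ t≥ slack = colouring-exists E e? cover w w control num t num≥ t≥ slack (good-[] uniform)

-- Rounding the bound on R

ℕ→ℚᵘ : ℕ → ℚᵘ
ℕ→ℚᵘ n = mkℚᵘ (ℤ.+ n) 0

toℚᵘ-⟦⟧ : ∀ n → ℚ.toℚᵘ ⟦ n ⟧ ℚᵘ.≃ ℕ→ℚᵘ n
toℚᵘ-⟦⟧ n = ℚₚ.toℚᵘ-fromℚᵘ (ℕ→ℚᵘ n)

⟦⟧-+ : ∀ a b → ⟦ a + b ⟧ ≡ ⟦ a ⟧ ℚ.+ ⟦ b ⟧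
⟦⟧-+ a b = ℚₚ.toℚᵘ-injective (begin
  ℚ.toℚᵘ ⟦ a + b ⟧                       ≈⟨ toℚᵘ-⟦⟧ (a + b) ⟩
  ℕ→ℚᵘ (a + b)                           ≈⟨ *≡* (cong (ℤ._* ℤ.+ 1) (sym (cong₂ ℤ._+_ (ℤₚ.*-identityʳ (ℤ.+ a)) (ℤₚ.*-identityʳ (ℤ.+ b))))) ⟩
  ℕ→ℚᵘ a ℚᵘ.+ ℕ→ℚᵘ b                     ≈⟨ ℚᵘₚ.+-cong (toℚᵘ-⟦⟧ a) (toℚᵘ-⟦⟧ b) ⟨
  ℚ.toℚᵘ ⟦ a ⟧ ℚᵘ.+ ℚ.toℚᵘ ⟦ b ⟧         ≈⟨ ℚₚ.toℚᵘ-homo-+ ⟦ a ⟧ ⟦ b ⟧ ⟨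
  ℚ.toℚᵘ (⟦ a ⟧ ℚ.+ ⟦ b ⟧) ∎)
  where open ℚᵘₚ.≃-Reasoning

⟦⟧-* : ∀ a b → ⟦ a * b ⟧ ≡ ⟦ a ⟧ ℚ.* ⟦ b ⟧
⟦⟧-* a b = ℚₚ.toℚᵘ-injective (begin
  ℚ.toℚᵘ ⟦ a * b ⟧                       ≈⟨ toℚᵘ-⟦⟧ (a * b) ⟩
  ℕ→ℚᵘ (a * b)                           ≈⟨ *≡* (cong (ℤ._* ℤ.+ 1) (ℤₚ.pos-* a b)) ⟩
  ℕ→ℚᵘ a ℚᵘ.* ℕ→ℚᵘ b                     ≈⟨ ℚᵘₚ.*-cong (toℚᵘ-⟦⟧ a) (toℚᵘ-⟦⟧ b) ⟨
  ℚ.toℚᵘ ⟦ a ⟧ ℚᵘ.* ℚ.toℚᵘ ⟦ b ⟧         ≈⟨ ℚₚ.toℚᵘ-homo-* ⟦ a ⟧ ⟦ b ⟧ ⟨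
  ℚ.toℚᵘ (⟦ a ⟧ ℚ.* ⟦ b ⟧) ∎)
  where open ℚᵘₚ.≃-Reasoning

⟦⟧-cancel-≤ : ∀ {a b} → ⟦ a ⟧ ℚ.≤ ⟦ b ⟧ → a ≤ b
⟦⟧-cancel-≤ {a} {b} h with ℚᵘₚ.≤-trans (ℚᵘₚ.≤-reflexive (ℚᵘₚ.≃-sym (toℚᵘ-⟦⟧ a)))
                             (ℚᵘₚ.≤-trans (ℚₚ.toℚᵘ-mono-≤ h) (ℚᵘₚ.≤-reflexive (toℚᵘ-⟦⟧ b)))
... | *≤* le = ℤₚ.drop‿+≤+ (subst₂ ℤ._≤_ (ℤₚ.*-identityʳ (ℤ.+ a)) (ℤₚ.*-identityʳ (ℤ.+ b)) le)

⟦⟧-mono-< : ∀ {a b} → a < b → ⟦ a ⟧ ℚ.< ⟦ b ⟧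
⟦⟧-mono-< {a} {b} a<b = ℚₚ.toℚᵘ-cancel-< (ℚᵘₚ.<-respˡ-≃ (ℚᵘₚ.≃-sym (toℚᵘ-⟦⟧ a))
  (ℚᵘₚ.<-respʳ-≃ (ℚᵘₚ.≃-sym (toℚᵘ-⟦⟧ b)) (*<* (subst₂ ℤ._<_ (sym (ℤₚ.*-identityʳ (ℤ.+ a))) (sym (ℤₚ.*-identityʳ (ℤ.+ b))) (ℤ.+<+ a<b)))))

⟦⟧-pos : ∀ n .{{_ : NonZero n}} → ℚ.Positive ⟦ n ⟧
⟦⟧-pos n = ℚ.positive (⟦⟧-mono-< (ℕ.>-nonZero⁻¹ n))

⟦⟧-nonNeg : ∀ n → 0ℚ ℚ.≤ ⟦ n ⟧
⟦⟧-nonNeg zero    = ℚₚ.≤-refl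
⟦⟧-nonNeg (suc n) = ℚₚ.<⇒≤ (⟦⟧-mono-< {0} {suc n} (s≤s z≤n))

^ℚ-scale : ∀ {r a M} i → r ℚ.* ⟦ M ⟧ ≡ ⟦ a ⟧ → (r ^ℚ i) ℚ.* ⟦ M ^ i ⟧ ≡ ⟦ a ^ i ⟧
^ℚ-scale zero _ = ℚₚ.*-identityˡ _
^ℚ-scale {r} {a} {M} (suc i) e = begin
  r ℚ.* (r ^ℚ i) ℚ.* ⟦ M * M ^ i ⟧               ≡⟨ cong (r ℚ.* (r ^ℚ i) ℚ.*_) (⟦⟧-* M (M ^ i)) ⟩
  r ℚ.* (r ^ℚ i) ℚ.* (⟦ M ⟧ ℚ.* ⟦ M ^ i ⟧)       ≡⟨ ℚ*.interchange r (r ^ℚ i) _ _ ⟩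
  r ℚ.* ⟦ M ⟧ ℚ.* ((r ^ℚ i) ℚ.* ⟦ M ^ i ⟧)       ≡⟨ cong₂ ℚ._*_ e (^ℚ-scale i e) ⟩
  ⟦ a ⟧ ℚ.* ⟦ a ^ i ⟧                            ≡⟨ ⟦⟧-* a (a ^ i) ⟨
  ⟦ a * a ^ i ⟧ ∎
  where open ≡-Reasoning

+-cancel-neg : ∀ x y → x ℚ.- y ℚ.+ y ≡ x
+-cancel-neg x y = trans (ℚₚ.+-assoc x (ℚ.- y) y) (trans (cong (x ℚ.+_) (ℚₚ.+-inverseˡ y)) (ℚₚ.+-identityʳ x))

⟦⟧-drop : ∀ i s → ⟦ i * suc s ⟧ ℚ.- ⟦ i ⟧ ≡ ⟦ i * s ⟧
⟦⟧-drop i s = begin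
  ⟦ i * suc s ⟧ ℚ.- ⟦ i ⟧                 ≡⟨ cong (λ y → ⟦ y ⟧ ℚ.- ⟦ i ⟧) (trans (*-suc i s) (+-comm i (i * s))) ⟩
  ⟦ i * s + i ⟧ ℚ.- ⟦ i ⟧                 ≡⟨ cong (ℚ._- ⟦ i ⟧) (⟦⟧-+ (i * s) i) ⟩
  ⟦ i * s ⟧ ℚ.+ ⟦ i ⟧ ℚ.- ⟦ i ⟧           ≡⟨ ℚₚ.+-assoc ⟦ i * s ⟧ ⟦ i ⟧ (ℚ.- ⟦ i ⟧) ⟩
  ⟦ i * s ⟧ ℚ.+ (⟦ i ⟧ ℚ.- ⟦ i ⟧)         ≡⟨ cong (⟦ i * s ⟧ ℚ.+_) (ℚₚ.+-inverseʳ ⟦ i ⟧) ⟩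
  ⟦ i * s ⟧ ℚ.+ 0ℚ                        ≡⟨ ℚₚ.+-identityʳ _ ⟩
  ⟦ i * s ⟧ ∎
  where open ≡-Reasoning

-- The search descends from `w` and stops at the first failure. The result is minimal only in that
-- its predecessor fails, which is what rounding up by less than one step means.
least : ∀ {P : ℕ → Set} → (∀ t → Dec (P t)) → ∀ w → P w → ∃ λ t → P t × (∀ {s} → suc s ≡ t → ¬ P s)
least P? zero    p = 0 , p , λ ()
least P? (suc w) p with P? w
... | yes q = least P? w q
... | no ¬q = suc w , p , λ { refl → ¬q }

^-positive : ∀ i → 1 ≤ i ^ i
^-positive zero    = s≤s z≤n
^-positive (suc i) = ℕ.>-nonZero⁻¹ (suc i ^ suc i) {{m^n≢0 (suc i) (suc i)}}

module Numerics {n k : ℕ} (H : Hypergraph n) (k≥2 : 2 ≤ k)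
  (inI? : ∀ i → Dec (InI k H i)) (num : ℕ → ℕ) where

  -- Rounding the i-th summand of the bound up to a multiple of i / M costs at most
  -- ∑ i / M ≤ 1 in total, which is the slack in the constant 2.
  m M : ℕ
  m = k ∸ 1
  M = m * m

  m≥1 : 1 ≤ m
  m≥1 = ∸-monoˡ-≤ 1 k≥2

  instance
    M≢0 : NonZero M
    M≢0 = >-nonZero (*-mono-≤ m≥1 m≥1)

  -- This says that i * t / M is at least the i-th summand of the bound.
  Above : ℕ → ℕ → Set
  Above i t = num i * M ^ i ≤ t ^ i * ((i ∸ 1) ^ (i ∸ 1) * (k ∸ i))

  above? : ∀ i t → Dec (Above i t)
  above? i t = num i * M ^ i ≤? t ^ i * ((i ∸ 1) ^ (i ∸ 1) * (k ∸ i))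

  above-witness : ∀ i → 1 ≤ i → i ≤ m → Above i (num i * M ^ i)
  above-witness (suc j) 1≤i i≤m = ≤-trans (self (num (suc j) * M ^ suc j))
    (≤-trans (≤-reflexive (sym (*-identityʳ _)))
             (*-monoʳ-≤ ((num (suc j) * M ^ suc j) ^ suc j) (*-mono-≤ (^-positive j) (m<n⇒0<n∸m i<k))))
    where
    i<k : suc j < k
    i<k = subst (suc j <_) (m+[n∸m]≡n (≤-trans (s≤s z≤n) k≥2)) (s≤s i≤m)
    self : ∀ w → w ≤ w ^ suc j
    self zero    = z≤n
    self (suc w) = ≤-trans (≤-reflexive (sym (*-identityʳ (suc w))))
                           (*-monoʳ-≤ (suc w) (ℕ.>-nonZero⁻¹ (suc w ^ j) {{m^n≢0 (suc w) j}}))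

  -- The value 1 for i ∉ I makes the approximation i * (t − 1) / M from below vanish.
  Rounded : ℕ → ℕ → Set
  Rounded i t = (InI k H i × Above i t × (∀ {s} → suc s ≡ t → ¬ Above i s)) ⊎ (¬ InI k H i × t ≡ 1)

  rounded : ∀ i → ∃ (Rounded i)
  rounded i with inI? i
  ... | no ∉I = 1 , inj₂ (∉I , refl)
  ... | yes inI@(1≤i , i≤ , _) with least (above? i) _ (above-witness i 1≤i i≤)
  ...   | t , above , minimal = t , inj₁ (inI , above , minimal)

  t : ℕ → ℕ
  t i = proj₁ (rounded i)

  -- As `i * t i / M` stands for a_i, this is `M` times β = 1 + Σ (i-1)/i · a_i. The summand `M`
  -- keeps it positive.
  B : ℕ
  B = M + ∑ (range m) (λ i → (i ∸ 1) * t i)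

  instance
    B≢0 : NonZero B
    B≢0 = >-nonZero (≤-trans (ℕ.>-nonZero⁻¹ M) (m≤m+n M _))

  -- The choice of q_i pays off here: t^i (i-1)^(i-1) is t ((i-1) t)^(i-1), and (i-1) t is one of
  -- the summands of `B`. In real terms, x_i β^(1-i) ≤ t / M.
  rounded-≥ : ∀ j {t} → (j * t) ≤ B → InI k H (suc j) → Rounded (suc j) t →
    num (suc j) * M ^ suc j ≤ t * B ^ j * (k ∸ suc j)
  rounded-≥ j     le inI (inj₂ (∉I , _))         = ⊥-elim (∉I inI)
  rounded-≥ j {t} le inI (inj₁ (_ , above , _)) = begin
    num (suc j) * M ^ suc j                     ≤⟨ above ⟩
    t ^ suc j * (j ^ j * (k ∸ suc j))           ≡⟨ rearrange t (t ^ j) (j ^ j) (k ∸ suc j) ⟩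
    t * (j ^ j * t ^ j) * (k ∸ suc j)           ≡⟨ cong (λ x → t * x * (k ∸ suc j)) (^-distribʳ-* j j t) ⟨
    t * (j * t) ^ j * (k ∸ suc j)               ≤⟨ *-monoˡ-≤ (k ∸ suc j) (*-monoʳ-≤ t (^-monoˡ-≤ j le)) ⟩
    t * B ^ j * (k ∸ suc j) ∎
    where
    open ≤-Reasoning
    rearrange : ∀ t a b c → t * a * (b * c) ≡ t * (b * a) * c
    rearrange = solve-∀

  t≥ : ∀ i → 1 ≤ i → i ≤ k ∸ 1 → InI k H i → num i * M ^ i ≤ t i * B ^ (i ∸ 1) * (k ∸ i)
  t≥ (suc j) 1≤i i≤ inI = rounded-≥ j
    (≤-trans (∑-term {xs = range m} (λ i → (i ∸ 1) * t i) (∈-range⁺ m 1≤i i≤)) (m≤n+m _ M))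
    inI (proj₂ (rounded (suc j)))

  ρ : ℚ
  ρ = ℚ.1/_ ⟦ M ⟧ {{ℚₚ.pos⇒nonZero ⟦ M ⟧ {{⟦⟧-pos M}}}}

  ρM≡1 : ρ ℚ.* ⟦ M ⟧ ≡ 1ℚ
  ρM≡1 = ℚₚ.*-inverseˡ ⟦ M ⟧ {{ℚₚ.pos⇒nonZero ⟦ M ⟧ {{⟦⟧-pos M}}}}

  instance
    M-pos : ℚ.Positive ⟦ M ⟧
    M-pos = ⟦⟧-pos M

  -- One step below the rounded value, that is i (t - 1) / M, because `BoundHolds` speaks only of
  -- rationals strictly below the summands. Subtraction takes place in ℚ, so that t = 0 gives a
  -- negative number.
  approx : ℕ → ℕ → ℚ
  approx i t = (⟦ i * t ⟧ ℚ.- ⟦ i ⟧) ℚ.* ρ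

  r : ℕ → ℚ
  r i = approx i (t i)

  scale : ∀ x → x ℚ.* ρ ℚ.* ⟦ M ⟧ ≡ x
  scale x = trans (ℚₚ.*-assoc x ρ ⟦ M ⟧) (trans (cong (x ℚ.*_) ρM≡1) (ℚₚ.*-identityʳ x))

  approx-below : ∀ i t → 1 ≤ i → InI k H i → Rounded i t → BelowTerm k i (num i) (approx i t)
  approx-below i t       1≤i inI (inj₂ (∉I , _)) = ⊥-elim (∉I inI)
  -- This case occurs when `num i` is zero: then the summand vanishes and only negative numbers lie
  -- below it.
  approx-below i zero    1≤i inI (inj₁ _) = inj₁ (ℚₚ.*-cancelʳ-<-nonNeg ⟦ M ⟧ {{ℚₚ.pos⇒nonNeg ⟦ M ⟧}} (begin-strict
    (⟦ i * 0 ⟧ ℚ.- ⟦ i ⟧) ℚ.* ρ ℚ.* ⟦ M ⟧     ≡⟨ scale _ ⟩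
    ⟦ i * 0 ⟧ ℚ.- ⟦ i ⟧                       ≡⟨ cong (λ x → ⟦ x ⟧ ℚ.- ⟦ i ⟧) (*-zeroʳ i) ⟩
    0ℚ ℚ.- ⟦ i ⟧                              ≡⟨ ℚₚ.+-identityˡ _ ⟩
    ℚ.- ⟦ i ⟧                                 <⟨ ℚₚ.neg-antimono-< (⟦⟧-mono-< 1≤i) ⟩
    ℚ.- 0ℚ                                    ≡⟨⟩
    0ℚ                                        ≡⟨ ℚₚ.*-zeroˡ ⟦ M ⟧ ⟨
    0ℚ ℚ.* ⟦ M ⟧ ∎))
    where open ℚₚ.≤-Reasoning
  approx-below i (suc s) 1≤i inI (inj₁ (_ , _ , minimal)) = inj₂ (nonNeg , ℚₚ.*-cancelʳ-<-nonNeg ⟦ M ^ i ⟧ {{ℚ.nonNegative (⟦⟧-nonNeg (M ^ i))}} (begin-strict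
    (x ^ℚ i) ℚ.* ⟦ c ⟧ ℚ.* ⟦ M ^ i ⟧          ≡⟨ ℚ*.xy∙z≈xz∙y (x ^ℚ i) ⟦ c ⟧ ⟦ M ^ i ⟧ ⟩
    (x ^ℚ i) ℚ.* ⟦ M ^ i ⟧ ℚ.* ⟦ c ⟧          ≡⟨ cong (ℚ._* ⟦ c ⟧) (^ℚ-scale {x} {i * s} {M} i xM) ⟩
    ⟦ (i * s) ^ i ⟧ ℚ.* ⟦ c ⟧                 ≡⟨ ⟦⟧-* ((i * s) ^ i) c ⟨
    ⟦ (i * s) ^ i * c ⟧                       <⟨ ⟦⟧-mono-< strictly ⟩
    ⟦ i ^ i * num i * M ^ i ⟧                 ≡⟨ ⟦⟧-* (i ^ i * num i) (M ^ i) ⟩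
    ⟦ i ^ i * num i ⟧ ℚ.* ⟦ M ^ i ⟧ ∎))
    where
    open ℚₚ.≤-Reasoning
    c : ℕ
    c = (i ∸ 1) ^ (i ∸ 1) * (k ∸ i)
    x : ℚ
    x = approx i (suc s)
    xM : x ℚ.* ⟦ M ⟧ ≡ ⟦ i * s ⟧
    xM = trans (scale _) (⟦⟧-drop i s)
    nonNeg : 0ℚ ℚ.≤ x
    nonNeg = ℚₚ.*-cancelʳ-≤-pos ⟦ M ⟧ (ℚₚ.≤-trans (ℚₚ.≤-reflexive (ℚₚ.*-zeroˡ ⟦ M ⟧))
      (ℚₚ.≤-trans (⟦⟧-nonNeg (i * s)) (ℚₚ.≤-reflexive (sym xM))))
    strictly : (i * s) ^ i * c < i ^ i * num i * M ^ i
    strictly = subst₂ _<_ (trans (sym (*-assoc (i ^ i) (s ^ i) c)) (cong (_* c) (sym (^-distribʳ-* i i s))))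
      (sym (*-assoc (i ^ i) (num i) (M ^ i)))
      (*-monoʳ-< (i ^ i) {{>-nonZero (^-positive i)}} (≰⇒> (minimal refl)))

  below : ∀ i → 1 ≤ i → i ≤ k ∸ 1 → InI k H i → BelowTerm k i (num i) (r i)
  below i 1≤i _ inI = approx-below i (t i) 1≤i inI (proj₂ (rounded i))

  approx-outside-I : ∀ i {t} → ¬ InI k H i → Rounded i t → approx i t ≡ 0ℚ
  approx-outside-I i ∉I (inj₁ (inI , _))  = ⊥-elim (∉I inI)
  approx-outside-I i ∉I (inj₂ (_ , refl)) = trans
    (cong (ℚ._* ρ) (trans (cong (λ x → ⟦ x ⟧ ℚ.- ⟦ i ⟧) (*-identityʳ i)) (ℚₚ.+-inverseʳ ⟦ i ⟧)))
    (ℚₚ.*-zeroˡ ρ)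

  outside-I : ∀ i → ¬ InI k H i → r i ≡ 0ℚ
  outside-I i ∉I = approx-outside-I i ∉I (proj₂ (rounded i))

  sum-scaled : ∀ l → sumℚ1 l r ℚ.* ⟦ M ⟧ ℚ.+ ⟦ ∑ (range l) id ⟧ ≡ ⟦ ∑ (range l) (λ i → i * t i) ⟧
  sum-scaled zero    = trans (ℚₚ.+-identityʳ _) (ℚₚ.*-zeroˡ ⟦ M ⟧)
  sum-scaled (suc l) = begin
    (s ℚ.+ r i) ℚ.* ⟦ M ⟧ ℚ.+ ⟦ i + σ ⟧                       ≡⟨ cong₂ ℚ._+_ (ℚₚ.*-distribʳ-+ ⟦ M ⟧ s (r i)) (trans (cong ⟦_⟧ (+-comm i σ)) (⟦⟧-+ σ i)) ⟩
    s ℚ.* ⟦ M ⟧ ℚ.+ r i ℚ.* ⟦ M ⟧ ℚ.+ (⟦ σ ⟧ ℚ.+ ⟦ i ⟧)       ≡⟨ ℚ+.interchange (s ℚ.* ⟦ M ⟧) (r i ℚ.* ⟦ M ⟧) ⟦ σ ⟧ ⟦ i ⟧ ⟩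
    s ℚ.* ⟦ M ⟧ ℚ.+ ⟦ σ ⟧ ℚ.+ (r i ℚ.* ⟦ M ⟧ ℚ.+ ⟦ i ⟧)       ≡⟨ cong₂ ℚ._+_ (sum-scaled l) (trans (cong (ℚ._+ ⟦ i ⟧) (scale (⟦ i * t i ⟧ ℚ.- ⟦ i ⟧))) (+-cancel-neg ⟦ i * t i ⟧ ⟦ i ⟧)) ⟩
    ⟦ ∑ (range l) (λ i → i * t i) ⟧ ℚ.+ ⟦ i * t i ⟧           ≡⟨ trans (cong ⟦_⟧ (+-comm (i * t i) τ)) (⟦⟧-+ τ (i * t i)) ⟨
    ⟦ ∑ (range (suc l)) (λ i → i * t i) ⟧ ∎
    where
    open ≡-Reasoning
    i σ τ : ℕ
    i = suc l
    τ = ∑ (range l) (λ i → i * t i)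
    σ = ∑ (range l) id
    s : ℚ
    s = sumℚ1 l r

  scaled-sum : ⟦ ∑ (range m) (λ i → i * t i) + 2 * M ⟧ ≡ (sumℚ1 m r ℚ.+ ⟦ 2 ⟧) ℚ.* ⟦ M ⟧ ℚ.+ ⟦ ∑ (range m) id ⟧
  scaled-sum = begin
    ⟦ ∑ (range m) (λ i → i * t i) + 2 * M ⟧           ≡⟨ ⟦⟧-+ (∑ (range m) (λ i → i * t i)) (2 * M) ⟩
    ⟦ ∑ (range m) (λ i → i * t i) ⟧ ℚ.+ ⟦ 2 * M ⟧     ≡⟨ cong₂ ℚ._+_ (sym (sum-scaled m)) (⟦⟧-* 2 M) ⟩
    s ℚ.* ⟦ M ⟧ ℚ.+ ⟦ σ ⟧ ℚ.+ ⟦ 2 ⟧ ℚ.* ⟦ M ⟧         ≡⟨ ℚ+.xy∙z≈xz∙y (s ℚ.* ⟦ M ⟧) ⟦ σ ⟧ (⟦ 2 ⟧ ℚ.* ⟦ M ⟧) ⟩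
    s ℚ.* ⟦ M ⟧ ℚ.+ ⟦ 2 ⟧ ℚ.* ⟦ M ⟧ ℚ.+ ⟦ σ ⟧         ≡⟨ cong (ℚ._+ ⟦ σ ⟧) (ℚₚ.*-distribʳ-+ ⟦ M ⟧ s ⟦ 2 ⟧) ⟨
    (s ℚ.+ ⟦ 2 ⟧) ℚ.* ⟦ M ⟧ ℚ.+ ⟦ σ ⟧ ∎
    where
    open ≡-Reasoning
    σ : ℕ
    σ = ∑ (range m) id
    s : ℚ
    s = sumℚ1 m r

  length-range : ∀ l → length (range l) ≡ l
  length-range zero    = refl
  length-range (suc l) = cong suc (length-range l)

  rounding-error : ∑ (range m) id ≤ M
  rounding-error = ≤-trans (∑-mono (range m) (λ i i∈ → proj₂ (∈-range⁻ m i∈)))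
    (≤-reflexive (trans (∑-const (range m) m) (cong (_* m) (length-range m))))

  module _ {R : ℕ} (bound : BoundHolds k H num R) where

    slack′ : M + ∑ (range m) (λ i → i * t i) ≤ M * R
    -- The constant 2 contributes `2 * M`: one `M` is cancelled against the rounding error, the
    -- other remains as the first summand of `B`.
    slack′ = +-cancelˡ-≤ M _ _ (begin
      M + (M + ∑ (range m) (λ i → i * t i))           ≡⟨ twice M _ ⟩
      ∑ (range m) (λ i → i * t i) + 2 * M             ≤⟨ ⟦⟧-cancel-≤ scaled ⟩
      R * M + ∑ (range m) id                          ≤⟨ +-monoʳ-≤ (R * M) rounding-error ⟩
      R * M + M                                       ≡⟨ cong₂ _+_ (*-comm R M) refl ⟩
      M * R + M                                       ≡⟨ +-comm (M * R) M ⟩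
      M + M * R ∎)
      where
      open ≤-Reasoning
      twice : ∀ a b → a + (a + b) ≡ b + 2 * a
      twice = solve-∀
      s : ℚ
      s = sumℚ1 m r
      σ : ℕ
      σ = ∑ (range m) id
      s≤ : s ℚ.+ ⟦ 2 ⟧ ℚ.≤ ⟦ R ⟧
      s≤ = ℚₚ.≤-trans (ℚₚ.+-monoˡ-≤ ⟦ 2 ⟧ (bound r below (λ i _ _ → outside-I i)))
                      (ℚₚ.≤-reflexive (+-cancel-neg ⟦ R ⟧ ⟦ 2 ⟧))
      scaled : ⟦ ∑ (range m) (λ i → i * t i) + 2 * M ⟧ ℚ.≤ ⟦ R * M + σ ⟧
      scaled = ℚₚ.≤-trans (ℚₚ.≤-reflexive scaled-sum) (ℚₚ.≤-trans
        (ℚₚ.+-monoˡ-≤ ⟦ σ ⟧ (ℚₚ.*-monoʳ-≤-nonNeg ⟦ M ⟧ {{ℚₚ.pos⇒nonNeg ⟦ M ⟧}} s≤))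
        (ℚₚ.≤-reflexive (sym (trans (⟦⟧-+ (R * M) σ) (cong (ℚ._+ ⟦ σ ⟧) (⟦⟧-* R M))))))

    -- The shares (i-1)/i · a_i in β and a_i / i for the bad extensions add up to a_i.
    slack : B + ∑ (range m) t ≤ M * R
    slack = ≤-trans (≤-reflexive (trans (+-assoc M _ _) (cong (M +_) (sym (∑-+ (range m) _ _)))))
      (≤-trans (+-monoʳ-≤ M (∑-mono (range m) (λ i i∈ → ≤-reflexive (merge i (proj₁ (∈-range⁻ m i∈)))))) slack′)
      where
      merge : ∀ i → 1 ≤ i → (i ∸ 1) * t i + t i ≡ i * t i
      merge (suc j) _ = +-comm (j * t (suc j)) (t (suc j))

    R≢0 : NonZero R
    R≢0 = ℕ.≢-nonZero λ { refl → contradiction (≤-trans (ℕ.>-nonZero⁻¹ M)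
      (≤-trans (≤-trans (m≤m+n M _) slack′) (≤-reflexive (*-zeroʳ M)))) λ () }

-- List colourings

lookup-injective : ∀ {xs : List ℕ} → Unique xs → ∀ {i j} → lookup xs i ≡ lookup xs j → i ≡ j
lookup-injective (_  ∷ _) {Fin.zero}  {Fin.zero}  _ = refl
lookup-injective (x∉ ∷ _) {Fin.zero}  {Fin.suc j} e = ⊥-elim (All.lookup x∉ (∈-lookup j) e)
lookup-injective (x∉ ∷ _) {Fin.suc i} {Fin.zero}  e = ⊥-elim (All.lookup x∉ (∈-lookup i) (sym e))
lookup-injective (_  ∷ u) {Fin.suc i} {Fin.suc j} e = cong Fin.suc (lookup-injective u e)

∣p∩t∣-split : ∀ {n} (p q t : Subset n) → ∣ p ∩ t ∣ ≡ ∣ (p ─ q) ∩ t ∣ + ∣ (p ∩ q) ∩ t ∣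
∣p∩t∣-split []            []            []            = refl
∣p∩t∣-split (outside ∷ p) (outside ∷ q) (_ ∷ t)       = ∣p∩t∣-split p q t
∣p∩t∣-split (outside ∷ p) (inside  ∷ q) (_ ∷ t)       = ∣p∩t∣-split p q t
∣p∩t∣-split (inside  ∷ p) (outside ∷ q) (outside ∷ t) = ∣p∩t∣-split p q t
∣p∩t∣-split (inside  ∷ p) (outside ∷ q) (inside  ∷ t) = cong suc (∣p∩t∣-split p q t)
∣p∩t∣-split (inside  ∷ p) (inside  ∷ q) (outside ∷ t) = ∣p∩t∣-split p q t
∣p∩t∣-split (inside  ∷ p) (inside  ∷ q) (inside  ∷ t) = trans (cong suc (∣p∩t∣-split p q t)) (sym (+-suc _ _))

colorCount≡count : ∀ {n} (f : Fin n → ℕ) (P : Subset n) c → colorCount f P c ≡ count c (map f (elems P))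
colorCount≡count f []            c = refl
colorCount≡count f (outside ∷ P) c = trans (colorCount≡count (f ∘ Fin.suc) P c) (cong (count c) (map-∘ (elems P)))
colorCount≡count f (inside ∷ P)  c = trans (head (f Fin.zero ≟ c))
  (trans (cong (ind (c ≟ f Fin.zero) +_) (trans (colorCount≡count (f ∘ Fin.suc) P c) (cong (count c) (map-∘ (elems P)))))
         (sym (count-∷ c (f Fin.zero) _)))
  where
  head : Dec (f Fin.zero ≡ c) → colorCount f (inside ∷ P) c ≡ ind (c ≟ f Fin.zero) + colorCount (f ∘ Fin.suc) P c
  head (yes e) rewrite Dec.dec-true (f Fin.zero ≟ c) e | ind-yes (c ≟ f Fin.zero) (sym e) = refl
  head (no ¬e) rewrite Dec.dec-false (f Fin.zero ≟ c) ¬e | ind-no (c ≟ f Fin.zero) (¬e ∘ sym) = refl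

module Main {n k Δ R : ℕ} (k≥2 : 2 ≤ k) (H : Hypergraph n) (uniform : Uniform k H) (maxDeg : MaxDegree≤ H Δ)
  (L : Fin n → List ℕ) (L-unique : ∀ v → Unique (L v)) (R≤ : ∀ v → R ≤ length (L v)) where

  -- Cutting each list down to its first `R` colours lets all colourings be vectors over the same
  -- `Fin R`.
  col : Fin n → Fin R → ℕ
  col v c = lookup (L v) (Fin.inject≤ c (R≤ v))

  col-inj : ∀ v {c d} → col v c ≡ col v d → c ≡ d
  col-inj v {c} {d} e = Finₚ.inject≤-injective (R≤ v) (R≤ v) c d (lookup-injective (L-unique v) e)

  inI? : ∀ i → Dec (InI k H i)
  inI? i with 1 ≤? i | i ≤? k ∸ 1
  ... | yes 1≤i | yes i≤ = Degrees.inI? H uniform maxDeg i 1≤i i≤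
  ... | no 1≰i  | _      = no λ (1≤i , _) → 1≰i 1≤i
  ... | _       | no i≰  = no λ (_ , i≤ , _) → i≰ i≤

  everywhere : ∀ P Q → Within (allFin n) P Q
  everywhere P Q = (λ x _ → ∈-allFin x) , (λ x _ → ∈-allFin x)

  sets : BoundHolds k H (numA k Δ) R → Σ (Fin n → ℕ) λ φ → ListColoring L φ × IEDS H φ
  sets bound = f , (λ v → ∈-lookup _) , ieds
    where
    open Numerics H k≥2 inI? (numA k Δ)
    instance
      R-nonZero : NonZero R
      R-nonZero = R≢0 bound
    open Colourings {k = k} {Δ} H uniform maxDeg col col-inj M B
    open Sets
    num≥ : ∀ i → Δ * ((k ∸ 1) * (Δ ∸ 1)) * (w i + w i) ≤ numA k Δ i
    num≥ i = ≤-reflexive (trans (rearrange Δ (k ∸ 1) (Δ ∸ 1) (2 ^ (k ∸ i)) (fubini i))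
      (cong (λ x → Δ * (Δ ∸ 1) * (k ∸ 1) * x * fubini i) (sym (^-distribˡ-+-* 2 (k ∸ i) 1))))
      where
      rearrange : ∀ a b c d e → a * (b * c) * (d * e + d * e) ≡ a * c * b * (d * 2) * e
      rearrange = solve-∀
    found : ∃ (Good (allFin n))
    found = exists (numA k Δ) t num≥ t≥ (slack bound)
    f : Fin n → ℕ
    f v = col v (Vec.lookup (proj₁ found) v)
    ieds : IEDS H f
    ieds P Q P∈ Q∈ P≢Q P∩Q same = good⇒¬bad (proj₁ found) (proj₂ found) P∈ Q∈ (P≢Q , P∩Q , everywhere P Q ,
      (λ u u∈P _ → transport (Equivalence.to (same (f u)) (u , u∈P , refl))) ,
      (λ u u∈Q _ → transport (Equivalence.from (same (f u)) (u , u∈Q , refl))))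
      where
      transport : ∀ {T c} → (∃ λ w → w ∈ T × f w ≡ c) → ∃ λ w → w ∈ T × w ∈ₗ allFin n × c ≡ f w
      transport (w , w∈ , e) = w , w∈ , ∈-allFin w , sym e

  multisets : BoundHolds k H (numB k Δ) R → Σ (Fin n → ℕ) λ φ → ListColoring L φ × IEDM H φ
  multisets bound = f , (λ v → ∈-lookup _) , iedm
    where
    open Numerics H k≥2 inI? (numB k Δ)
    instance
      R-nonZero : NonZero R
      R-nonZero = R≢0 bound
    open Colourings {k = k} {Δ} H uniform maxDeg col col-inj M B
    open Multisets
    num≥ : ∀ i → Δ * ((k ∸ 1) * (Δ ∸ 1)) * (i ! + 0) ≤ numB k Δ i
    num≥ i = ≤-reflexive (rearrange Δ (k ∸ 1) (Δ ∸ 1) (i !))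
      where
      rearrange : ∀ a b c d → a * (b * c) * (d + 0) ≡ a * c * b * d
      rearrange = solve-∀
    found : ∃ (Good (allFin n))
    found = exists (numB k Δ) t num≥ t≥ (slack bound)
    f : Fin n → ℕ
    f v = col v (Vec.lookup (proj₁ found) v)
    iedm : IEDM H f
    iedm P Q P∈ Q∈ P≢Q P∩Q same = good⇒¬bad (proj₁ found) (proj₂ found) P∈ Q∈ (P≢Q , P∩Q , everywhere P Q , differences)
      where
      differences : Conflict (allFin n) P Q (proj₁ found)
      -- The vertices of P ∩ Q contribute equally to both colour counts and are cancelled.
      differences c = begin
        count c (map f (elems (P ─ Q)))         ≡⟨ colorCount≡count f (P ─ Q) c ⟨
        colorCount f (P ─ Q) c                  ≡⟨ +-cancelʳ-≡ (colorCount f (P ∩ Q) c) _ _ whole ⟩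
        colorCount f (Q ─ P) c                  ≡⟨ colorCount≡count f (Q ─ P) c ⟩
        count c (map f (elems (Q ─ P))) ∎
        where
        open ≡-Reasoning
        class : Subset n
        class = Vec.tabulate (λ v → does (f v ≟ c))
        whole : colorCount f (P ─ Q) c + colorCount f (P ∩ Q) c ≡ colorCount f (Q ─ P) c + colorCount f (P ∩ Q) c
        whole = trans (sym (∣p∩t∣-split P Q class)) (trans (same c) (trans (∣p∩t∣-split Q P class)
          (cong (λ T → colorCount f (Q ─ P) c + ∣ T ∩ class ∣) (∩-comm Q P))))

theorem3p1 : (k : ℕ) → 2 ≤ k → (n : ℕ) → (H : Hypergraph n) → Uniform k H →
    (Δ : ℕ) → MaxDegree≤ H Δ →
    (R : ℕ) → (L : Fin n → List ℕ) → (∀ v → Unique (L v)) → (∀ v → R ≤ length (L v)) →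
    (BoundHolds k H (numA k Δ) R →
    Σ (Fin n → ℕ) λ φ → ListColoring L φ × IEDS H φ)
    × (BoundHolds k H (numB k Δ) R →
    Σ (Fin n → ℕ) λ φ → ListColoring L φ × IEDM H φ)
theorem3p1 k k≥2 n H uniform Δ maxDeg R L L-unique R≤ = sets , multisets
  where open Main k≥2 H uniform maxDeg L L-unique R≤
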